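{- Let $\pi\in S_n$ have LTR-max decomposition $\pi=M_1P_1M_2$ with $M_2\neq\emptyset$, and let $m_1=|M_1|$, $p_1=|P_1|$, $m_2=|M_2|$. Then \[|q^{ -1}(\pi)|=\sum_{i=1}^{m_2}\sum_{j=0}^{i-1}\binom{i-1}{j}\,b_{m_1+j+1,\,m_1}\,b_{m_2+p_1-j,\,m_2-i+1}.\]
   Context: $S_n$ is the set of permutations of $\{1,\dots,n\}$ in one-line notation. An entry $\pi_i$ is a left-to-right (LTR) maximum if $\pi_i>\pi_j$ for all $j<i$. The map $q:S_n\to S_n$ (the algorithm Queuesort, sorting with a queue allowing bypass): let $m_1,\dots,m_r$ be the LTR maxima of $\pi$ from left to right; for $i=r,\dots,1$ in this order, repeatedly swap $m_i$ with the entry immediately to its right as long as such an entry exists and is smaller than $m_i$; the result is $q(\pi)$. $q^{ -1}(\pi)=\{\sigma: q(\sigma)=\pi\}$. The LTR-max decomposition $\pi=M_1P_1M_2$ means: $M_1$ is the maximal initial factor of consecutive LTR maxima, $P_1$ is a nonempty factor of non-LTR-maxima, and $M_2$ is the final factor consisting of LTR maxima, and these are all the LTR maxima. $S_n(321)$ is the set of $321$-avoiding permutations in $S_n$ (no $a<b<c$ with $\pi_a>\pi_b>\pi_c$). For $n\ge1$, $1\le i\le n$: $b_{n,i}=|\{\pi\in S_n(321):\pi_i=n\}|$. -}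

module Defs where

open import Data.Nat using (ℕ; zero; suc; _+_; _∸_; _<ᵇ_; _≡ᵇ_)
open import Data.Nat.Combinatorics using (_C_)
open import Data.Bool using (Bool; true; false; if_then_else_; _∧_; _∨_; not; T)
open import Data.List using (List; []; _∷_; length; filter; map; upTo; concatMap; foldr)
open import Data.Nat.ListAction using (sum)
open import Data.Bool.ListAction using (any)
open import Data.Maybe using (Maybe; just; nothing)

boolFilter : {A : Set} → (A → Bool) → List A → List A
boolFilter p []       = []
boolFilter p (x ∷ xs) = if p x then x ∷ boolFilter p xs else boolFilter p xs

-- Permutations of {1,…,n} are lists of naturals in one-line notation.

words : ℕ → ℕ → List (List ℕ)
words zero    n = [] ∷ []
words (suc k) n = concatMap (λ a → map (a ∷_) (words k n)) (map suc (upTo n))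

notIn : ℕ → List ℕ → Bool
notIn x []       = true
notIn x (y ∷ ys) = not (x ≡ᵇ y) ∧ notIn x ys

distinct : List ℕ → Bool
distinct []       = true
distinct (x ∷ xs) = notIn x xs ∧ distinct xs

S : ℕ → List (List ℕ)
S n = boolFilter distinct (words n n)

-- left-to-right maxima, listed from left to right (entries are ≥ 1)
ltrMaxFrom : ℕ → List ℕ → List ℕ
ltrMaxFrom cur []       = []
ltrMaxFrom cur (x ∷ xs) = if cur <ᵇ x then x ∷ ltrMaxFrom x xs else ltrMaxFrom cur xs

ltrMaxima : List ℕ → List ℕ
ltrMaxima = ltrMaxFrom 0

push : ℕ → List ℕ → List ℕ
push m []       = m ∷ []
push m (y ∷ ys) = if y <ᵇ m then y ∷ push m ys else m ∷ y ∷ ys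

bubble : ℕ → List ℕ → List ℕ
bubble m []       = []
bubble m (x ∷ xs) = if x ≡ᵇ m then push m xs else x ∷ bubble m xs

-- Queuesort: with LTR maxima m₁,…,m_r, apply bubble m_r first, then m_{r-1}, …, m₁
q : List ℕ → List ℕ
q π = foldr bubble π (ltrMaxima π)

qPreimage : ℕ → List ℕ → List (List ℕ)
qPreimage n π = boolFilter (λ σ → listEq (q σ) π) (S n)
  where
  listEq : List ℕ → List ℕ → Bool
  listEq []       []       = true
  listEq (x ∷ xs) (y ∷ ys) = (x ≡ᵇ y) ∧ listEq xs ys
  listEq _        _        = false

has21below : ℕ → List ℕ → Bool
has21below x []       = false
has21below x (y ∷ ys) = ((y <ᵇ x) ∧ any (λ z → z <ᵇ y) ys) ∨ has21below x ys

avoids321 : List ℕ → Bool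
avoids321 []       = true
avoids321 (x ∷ xs) = not (has21below x xs) ∧ avoids321 xs

-- 1-based entry π_i
entry : ℕ → List ℕ → Maybe ℕ
entry i       []       = nothing
entry zero    (x ∷ xs) = nothing
entry (suc zero) (x ∷ xs) = just x
entry (suc (suc i)) (x ∷ xs) = entry (suc i) xs

isJust≡ : Maybe ℕ → ℕ → Bool
isJust≡ (just x) n = x ≡ᵇ n
isJust≡ nothing  n = false

b : ℕ → ℕ → ℕ
b n i = length (boolFilter (λ π → avoids321 π ∧ isJust≡ (entry i π) n) (S n))

formula : ℕ → ℕ → ℕ → ℕ
formula m₁ p₁ m₂ =
  sum (map (λ k → let i = suc k in
         sum (map (λ j → ((i ∸ 1) C j) * b (m₁ + j + 1) m₁ * b (m₂ + p₁ ∸ j) (m₂ ∸ i + 1))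
                  (upTo i)))
       (upTo m₂))
  where open Data.Nat using (_*_)

{-# OPTIONS --safe #-}

-- Queuesort obeys a one-pass recursion qFrom: reading y under the current maximum c, output y
-- if y ≤ c, and otherwise push y into the result of the remaining input. Hence the words sent to
-- a target T can be counted letter by letter: a letter a > c must be a removable entry of T
-- (all entries before it are smaller, the next one is not), a letter a ≤ c must be the head of T.
--
-- If T = A ++ U with A ≤ c < U and U increasing, only the sizes d = |A|, u = |U| matter and the
-- count is ballot d u, where ballot (d+1) (u+1) = ballot d (u+1) + ballot (d+2) u. Since 321-avoiding
-- permutations are those sorted by q, tracking the position of n shows b (d+u+1) (u+1) = ballot d u.
--
-- If T = A ++ B ++ z ∷ P ++ D, where z > P blocks its own removal, the count satisfies the same
-- recursion in (|A|, |B|) with other boundary values. Expanding these boundary values in binomial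
-- coefficients, a reversal symmetry of the recursion (paths-ψ≡ballot) turns the count into a
-- binomial double sum of products of two ballot numbers.
module Submission where

open import Defs
open import Data.Bool using (Bool; true; false; if_then_else_; _∧_; _∨_; not)
open import Data.Bool.ListAction using (any)
open import Data.Bool.Properties using (∧-zeroʳ; ∧-identityʳ)
open import Data.Empty using (⊥)
open import Data.List hiding (sum; any; find)
open import Data.List.Membership.Propositional using (_∈_; _∉_; find)
open import Data.List.Membership.Propositional.Properties
open import Data.List.Properties hiding (sum-++)
open import Data.List.Relation.Binary.Permutation.Propositional using (_↭_; prep; swap; ↭-sym; ↭⇒↭ₛ)
open import Data.List.Relation.Binary.Permutation.Propositional.Properties using (∈-resp-↭; All-resp-↭; ↭-length)
import Data.List.Relation.Binary.Permutation.Setoid.Properties as Permₛ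
open import Data.List.Relation.Unary.All as All using (All; []; _∷_)
open import Data.List.Relation.Unary.All.Properties using (++⁺; ++⁻ˡ; ++⁻ʳ)
open import Data.List.Relation.Unary.AllPairs as AllPairs using (AllPairs; []; _∷_)
open import Data.List.Relation.Unary.Any using (here; there)
open import Data.List.Relation.Unary.Linked using (Linked; [-]; _∷_)
open import Data.List.Relation.Unary.Linked.Properties using (AllPairs⇒Linked; Linked⇒AllPairs)
open import Data.List.Relation.Unary.Unique.Propositional using (Unique)
open import Data.Maybe as Maybe using (Maybe; just; nothing; maybe′)
open import Data.Nat
open import Data.Nat.Combinatorics using (_C_; nCk+nC[k+1]≡[n+1]C[k+1]; k>n⇒nCk≡0)
open import Data.Nat.ListAction using (sum)
open import Data.Nat.ListAction.Properties using (sum-++)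
open import Data.Nat.Properties
open import Data.Nat.Tactic.RingSolver using (solve-∀)
open import Data.Product using (_×_; _,_; proj₁; proj₂; ∃₂)
open import Data.Sum using (inj₁; inj₂; [_,_]′)
open import Function using (_∘_; _$_)
open import Relation.Binary.Definitions using (tri<; tri≈; tri>)
open import Relation.Binary.PropositionalEquality
open import Relation.Nullary using (contradiction)
open ≡-Reasoning

-- Finite sums

interchange : ∀ a b c d → (a + b) + (c + d) ≡ (a + c) + (b + d)
interchange = solve-∀

Σ< : ℕ → (ℕ → ℕ) → ℕ
Σ< n f = sum (map f (upTo n))

Σ<-suc : ∀ n f → Σ< (suc n) f ≡ f 0 + Σ< n (f ∘ suc)
Σ<-suc n f = cong (λ xs → f 0 + sum xs) $
  trans (map-applyUpTo suc f n) (sym (map-upTo (f ∘ suc) n))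

Σ<-cong : ∀ n {f h} → (∀ i → i < n → f i ≡ h i) → Σ< n f ≡ Σ< n h
Σ<-cong zero    eq = refl
Σ<-cong (suc n) {f} {h} eq = begin
  Σ< (suc n) f            ≡⟨ Σ<-suc n f ⟩
  f 0 + Σ< n (f ∘ suc)    ≡⟨ cong₂ _+_ (eq 0 z<s) (Σ<-cong n (λ i i<n → eq (suc i) (s<s i<n))) ⟩
  h 0 + Σ< n (h ∘ suc)    ≡⟨ Σ<-suc n h ⟨
  Σ< (suc n) h            ∎

Σ<-+ : ∀ n f h → Σ< n (λ i → f i + h i) ≡ Σ< n f + Σ< n h
Σ<-+ zero    f h = refl
Σ<-+ (suc n) f h = begin
  Σ< (suc n) (λ i → f i + h i)                           ≡⟨ Σ<-suc n (λ i → f i + h i) ⟩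
  (f 0 + h 0) + Σ< n (λ i → f (suc i) + h (suc i))       ≡⟨ cong (f 0 + h 0 +_) (Σ<-+ n (f ∘ suc) (h ∘ suc)) ⟩
  (f 0 + h 0) + (Σ< n (f ∘ suc) + Σ< n (h ∘ suc))        ≡⟨ interchange (f 0) (h 0) _ _ ⟩
  (f 0 + Σ< n (f ∘ suc)) + (h 0 + Σ< n (h ∘ suc))        ≡⟨ cong₂ _+_ (Σ<-suc n f) (Σ<-suc n h) ⟨
  Σ< (suc n) f + Σ< (suc n) h                            ∎

Σ<-last : ∀ n f → Σ< (suc n) f ≡ Σ< n f + f n
Σ<-last zero    f = +-comm (f 0) 0
Σ<-last (suc n) f = begin
  Σ< (suc (suc n)) f                       ≡⟨ Σ<-suc (suc n) f ⟩
  f 0 + Σ< (suc n) (f ∘ suc)               ≡⟨ cong (f 0 +_) (Σ<-last n (f ∘ suc)) ⟩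
  f 0 + (Σ< n (f ∘ suc) + f (suc n))       ≡⟨ +-assoc (f 0) _ _ ⟨
  f 0 + Σ< n (f ∘ suc) + f (suc n)         ≡⟨ cong (_+ f (suc n)) (Σ<-suc n f) ⟨
  Σ< (suc n) f + f (suc n)                 ∎

-- Pascal's rule in each term; the unshifted sum loses its top term because `k C suc k` is zero.
Σ<-pascal : ∀ k (f : ℕ → ℕ) → Σ< (suc (suc k)) (λ j → (suc k C j) * f j)
                  ≡ Σ< (suc k) (λ j → (k C j) * f (suc j)) + Σ< (suc k) (λ j → (k C j) * f j)
Σ<-pascal k f = begin
  Σ< (2 + k) (λ j → (suc k C j) * f j)
    ≡⟨ Σ<-suc (suc k) (λ j → (suc k C j) * f j) ⟩
  f₀ + Σ< (suc k) (λ j → (suc k C suc j) * f (suc j))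
    ≡⟨ cong (f₀ +_) (Σ<-cong (suc k) (λ j _ → split j)) ⟩
  f₀ + Σ< (suc k) (λ j → (k C j) * f (suc j) + (k C suc j) * f (suc j))
    ≡⟨ cong (f₀ +_) (Σ<-+ (suc k) (λ j → (k C j) * f (suc j)) (λ j → (k C suc j) * f (suc j))) ⟩
  f₀ + (X + Σ< (suc k) (λ j → (k C suc j) * f (suc j)))
    ≡⟨ rotate f₀ X _ ⟩
  X + (f₀ + Σ< (suc k) (λ j → (k C suc j) * f (suc j)))
    ≡⟨ cong (X +_) (Σ<-suc (suc k) (λ j → (k C j) * f j)) ⟨
  X + Σ< (2 + k) (λ j → (k C j) * f j)
    ≡⟨ cong (X +_) (Σ<-last (suc k) (λ j → (k C j) * f j)) ⟩
  X + (Y + (k C suc k) * f (suc k))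
    ≡⟨ cong (λ c → X + (Y + c * f (suc k))) (k>n⇒nCk≡0 (n<1+n k)) ⟩
  X + (Y + 0)
    ≡⟨ cong (X +_) (+-identityʳ Y) ⟩
  X + Y ∎
  where
  f₀ = (k C 0) * f 0
  X = Σ< (suc k) (λ j → (k C j) * f (suc j))
  Y = Σ< (suc k) (λ j → (k C j) * f j)
  split : ∀ j → (suc k C suc j) * f (suc j) ≡ (k C j) * f (suc j) + (k C suc j) * f (suc j)
  split j = trans (cong (_* f (suc j)) (sym (nCk+nC[k+1]≡[n+1]C[k+1] k j)))
                  (*-distribʳ-+ (f (suc j)) (k C j) (k C suc j))
  rotate : ∀ a b c → a + (b + c) ≡ b + (a + c)
  rotate = solve-∀

-- Ballot numbers

-- Weighted count of lattice paths from height `d` that stay at or above 0. A step goes down by one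
-- or goes up by one at the cost of one of the `u` up-steps; a path ends once these are used up,
-- with the weight `φ` of its final height.
paths : (ℕ → ℕ) → ℕ → ℕ → ℕ
paths φ d       zero    = φ d
paths φ zero    (suc u) = paths φ 1 u
paths φ (suc d) (suc u) = paths φ d (suc u) + paths φ (suc (suc d)) u

-- With weight 1 every path is completed by its unique descent to 0, so these are the ballot
-- numbers; `ballot 0 u` is a Catalan number.
ballot : ℕ → ℕ → ℕ
ballot = paths (λ _ → 1)

-- Reading one letter from the state (d , u): either the next of the d pending smaller entries is
-- output, or the (e+1)-st of the u larger ones is enqueued, which leads to (d + e , u ∸ suc e).
-- Σdiag adds up the second kind, and paths-step is the resulting recursion.
Σdiag : (ℕ → ℕ → ℕ) → ℕ → ℕ → ℕ
Σdiag f d zero    = 0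
Σdiag f d (suc u) = f d u + Σdiag f (suc d) u

atPred : (ℕ → ℕ) → ℕ → ℕ
atPred f zero    = 0
atPred f (suc d) = f d

prefixSums : (ℕ → ℕ) → ℕ → ℕ
prefixSums τ zero    = τ 0
prefixSums τ (suc d) = prefixSums τ d + τ (suc d)

-- The sum along the diagonal telescopes by the recursion of `paths`. Boundary values with
-- successive differences `τ` absorb the extra term at the end of the diagonal.
Σdiag-paths : ∀ τ d u → let f = paths (prefixSums τ) in
              Σdiag f d (suc u) + τ (d + suc u) ≡ f (suc d) u
Σdiag-paths τ d zero    =
  cong₂ _+_ (+-identityʳ (prefixSums τ d)) (cong τ (+-comm d 1))
Σdiag-paths τ d (suc u) = begin
  (f d (suc u) + Σdiag f (suc d) (suc u)) + τ (d + suc (suc u))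
    ≡⟨ +-assoc (f d (suc u)) _ _ ⟩
  f d (suc u) + (Σdiag f (suc d) (suc u) + τ (d + suc (suc u)))
    ≡⟨ cong (λ k → f d (suc u) + (Σdiag f (suc d) (suc u) + τ k)) (+-suc d (suc u)) ⟩
  f d (suc u) + (Σdiag f (suc d) (suc u) + τ (suc d + suc u))
    ≡⟨ cong (f d (suc u) +_) (Σdiag-paths τ (suc d) u) ⟩
  f (suc d) (suc u) ∎
  where f = paths (prefixSums τ)

paths-step : ∀ τ d u → let f = paths (prefixSums τ) in
             f d u ≡ atPred (λ d → f d u) d + (Σdiag f d u + τ (d + u))
paths-step τ zero    zero    = refl
paths-step τ (suc d) zero    = cong (λ k → prefixSums τ d + τ (suc k)) (sym (+-identityʳ d))
paths-step τ zero    (suc u) = sym (Σdiag-paths τ 0 u)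
paths-step τ (suc d) (suc u) = cong (paths (prefixSums τ) d (suc u) +_) (sym (Σdiag-paths τ (suc d) u))

-- The case of `Σdiag-paths` in which `τ` is 1 at 0 and 0 elsewhere.
Σdiag-ballot : ∀ d u → Σdiag ballot d (suc u) ≡ ballot (suc d) u
Σdiag-ballot d zero    = refl
Σdiag-ballot d (suc u) = cong (ballot d (suc u) +_) (Σdiag-ballot (suc d) u)

paths-cong : ∀ {φ χ} → (∀ d → φ d ≡ χ d) → ∀ d u → paths φ d u ≡ paths χ d u
paths-cong eq d       zero    = eq d
paths-cong eq zero    (suc u) = paths-cong eq 1 u
paths-cong eq (suc d) (suc u) = cong₂ _+_ (paths-cong eq d (suc u)) (paths-cong eq (suc (suc d)) u)

-- Multiset coefficients and the reversal of paths

-- The number of multisets of size `j` drawn from `D` kinds.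
pascal : ℕ → ℕ → ℕ
pascal D       zero    = 1
pascal zero    (suc j) = 0
pascal (suc D) (suc j) = pascal D (suc j) + pascal (suc D) j

pascal₁ : ∀ j → pascal 1 j ≡ 1
pascal₁ zero    = refl
pascal₁ (suc j) = pascal₁ j

-- The binomial coefficient of `d + j` over `j`, hence symmetric in `d` and `j`.
ψ : ℕ → ℕ → ℕ
ψ j d = pascal (suc d) j

-- Boundary case of the recursion in `j`: it mirrors the forced up-step of `paths` at height 0, with
-- `j` in the role of the height.
paths-ψ₀ : ∀ d u → paths (ψ 0) d (suc u) ≡ paths (ψ 1) d u
paths-ψ₀ zero    zero    = refl
paths-ψ₀ (suc d) zero    = cong (_+ 1) (paths-ψ₀ d zero)
paths-ψ₀ zero    (suc u) = paths-ψ₀ 1 u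
paths-ψ₀ (suc d) (suc u) = cong₂ _+_ (paths-ψ₀ d (suc u)) (paths-ψ₀ (suc (suc d)) u)

-- The recursion that defines paths in d holds in j as well, so that the two ends of the path can
-- be exchanged in paths-ψ≡ballot.
paths-ψ : ∀ j d u → paths (ψ (suc j)) d (suc u) ≡ paths (ψ j) d (suc u) + paths (ψ (suc (suc j))) d u
paths-ψ j zero    zero    = begin
  pascal 1 j + ψ j 1            ≡⟨ +-comm (pascal 1 j) (ψ j 1) ⟩
  ψ j 1 + pascal 1 j            ∎
paths-ψ j (suc d) zero    = trans (cong (_+ ψ (suc j) (suc (suc d))) (paths-ψ j d zero))
  (lem (paths (ψ j) d 1) (ψ (suc (suc j)) d) (ψ (suc j) (suc d)) (ψ j (suc (suc d))))
  where
  lem : ∀ a b c d → (a + b) + (c + d) ≡ (a + d) + (b + c)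
  lem = solve-∀
paths-ψ j zero    (suc u) = paths-ψ j 1 u
paths-ψ j (suc d) (suc u) =
  trans (cong₂ _+_ (paths-ψ j d (suc u)) (paths-ψ j (suc (suc d)) u))
        (interchange (paths (ψ j) d (suc (suc u))) _ _ _)

-- As functions of `j` and `u` both sides obey the recursion that defines `ballot`: a weight `ψ j`
-- at the end of the path is traded for a start at height `j`.
paths-ψ≡ballot : ∀ j u → paths (ψ j) 0 u ≡ ballot j u
paths-ψ≡ballot j       zero    = pascal₁ j
paths-ψ≡ballot zero    (suc u) = trans (paths-ψ₀ 0 u) (paths-ψ≡ballot 1 u)
paths-ψ≡ballot (suc j) (suc u) =
  trans (paths-ψ j 0 u) (cong₂ _+_ (paths-ψ≡ballot j (suc u)) (paths-ψ≡ballot (suc (suc j)) u))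

-- Binomial double sums of ballot numbers

-- The recursion in v of the double sum in binSum-binomial.
binSum : (ℕ → ℕ) → ℕ → ℕ → ℕ
binSum c s zero    = c 0
binSum c s (suc v) = c 0 * ballot s (suc v) + (binSum (c ∘ suc) s v + binSum c (suc s) v)

binSum-cong : ∀ {c e} → (∀ j → c j ≡ e j) → ∀ s v → binSum c s v ≡ binSum e s v
binSum-cong eq s zero    = eq 0
binSum-cong eq s (suc v) = cong₂ _+_ (cong (_* ballot s (suc v)) (eq 0))
                                (cong₂ _+_ (binSum-cong (eq ∘ suc) s v) (binSum-cong eq (suc s) v))

binSum-zero : ∀ s v → binSum (λ _ → 0) s v ≡ 0
binSum-zero s zero    = refl
binSum-zero s (suc v) = cong₂ _+_ (binSum-zero s v) (binSum-zero (suc s) v)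

binSum-+ : ∀ c e s v → binSum (λ j → c j + e j) s v ≡ binSum c s v + binSum e s v
binSum-+ c e s zero    = refl
binSum-+ c e s (suc v) = trans
  (cong₂ (λ x y → (c 0 + e 0) * ballot s (suc v) + (x + y)) (binSum-+ (c ∘ suc) (e ∘ suc) s v) (binSum-+ c e (suc s) v))
  (lem (c 0) (e 0) (ballot s (suc v)) (binSum (c ∘ suc) s v) (binSum (e ∘ suc) s v) (binSum c (suc s) v) (binSum e (suc s) v))
  where
  lem : ∀ c e w a b x y → (c + e) * w + ((a + b) + (x + y)) ≡ (c * w + (a + x)) + (e * w + (b + y))
  lem = solve-∀

-- Raising `D` by one has the effect of raising `s` by one (`shift`), which turns the recursion of
-- `binSum` into that of `ballot`. The lemma serves to expand a ballot number so that `D` enters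
-- through the coefficients only.
binSum-pascal : ∀ D s v → binSum (pascal D) s v ≡ ballot (suc (D + s)) v
binSum-pascal D       s zero    = refl
binSum-pascal zero    s (suc v) = begin
  1 * ballot s (suc v) + (binSum (λ _ → 0) s v + binSum (pascal 0) (suc s) v)
    ≡⟨ cong₂ _+_ (*-identityˡ (ballot s (suc v))) (cong₂ _+_ (binSum-zero s v) (binSum-pascal 0 (suc s) v)) ⟩
  ballot s (suc v) + ballot (suc (suc s)) v ∎
binSum-pascal (suc D) s (suc v) = begin
  1 * ballot s (suc v) + (binSum (λ j → pascal D (suc j) + pascal (suc D) j) s v + binSum (pascal (suc D)) (suc s) v)
    ≡⟨ cong (λ x → 1 * ballot s (suc v) + (x + binSum (pascal (suc D)) (suc s) v)) (binSum-+ (pascal D ∘ suc) (pascal (suc D)) s v) ⟩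
  1 * ballot s (suc v) + ((binSum (pascal D ∘ suc) s v + binSum (pascal (suc D)) s v) + binSum (pascal (suc D)) (suc s) v)
    ≡⟨ cong₂ (λ x y → 1 * ballot s (suc v) + ((binSum (pascal D ∘ suc) s v + x) + y)) shift (binSum-pascal (suc D) (suc s) v) ⟩
  1 * ballot s (suc v) + ((binSum (pascal D ∘ suc) s v + binSum (pascal D) (suc s) v) + ballot (2 + D + suc s) v)
    ≡⟨ +-assoc (1 * ballot s (suc v)) _ _ ⟨
  binSum (pascal D) s (suc v) + ballot (2 + D + suc s) v
    ≡⟨ cong₂ _+_ (binSum-pascal D s (suc v)) (cong (λ k → ballot (2 + k) v) (+-suc D s)) ⟩
  ballot (suc (suc D + s)) (suc v) ∎
  where
  shift : binSum (pascal (suc D)) s v ≡ binSum (pascal D) (suc s) v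
  shift = trans (binSum-pascal (suc D) s v)
             (trans (cong (λ k → ballot (suc k) v) (sym (+-suc D s))) (sym (binSum-pascal D (suc s) v)))

-- `paths` is linear in its boundary values and `binSum` in its coefficients, so the two can be
-- exchanged.
paths-binSum : ∀ (φ : ℕ → ℕ → ℕ) s v d u →
          paths (λ d → binSum (λ j → φ j d) s v) d u ≡ binSum (λ j → paths (φ j) d u) s v
paths-binSum φ s v d       zero    = refl
paths-binSum φ s v zero    (suc u) = paths-binSum φ s v 1 u
paths-binSum φ s v (suc d) (suc u) =
  trans (cong₂ _+_ (paths-binSum φ s v d (suc u)) (paths-binSum φ s v (suc (suc d)) u))
        (sym (binSum-+ (λ j → paths (φ j) d (suc u)) _ s v))

-- Equal to Σdiag ballot (k + suc p) (suc v): the next left-to-right maximum is the (e+1)-st entry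
-- of the final increasing factor, whose length is suc v, while k entries before z, z itself and
-- the p entries of the block are still to be output.
afterBlock : ℕ → ℕ → ℕ → ℕ
afterBlock p v k = ballot (2 + (k + p)) v

-- A hockey-stick identity: by `binSum-pascal` the summands have coefficients `pascal (suc k) j`,
-- and these add up over `k ≤ d` to `pascal (suc d) (suc j)`.
prefixSums-afterBlock : ∀ p v d → prefixSums (afterBlock p v) d ≡ binSum (λ j → ψ (suc j) d) p v
prefixSums-afterBlock p v zero    = sym (binSum-pascal 1 p v)
prefixSums-afterBlock p v (suc d) = begin
  prefixSums (afterBlock p v) d + ballot (3 + (d + p)) v
    ≡⟨ cong₂ _+_ (prefixSums-afterBlock p v d) (sym (binSum-pascal (suc (suc d)) p v)) ⟩
  binSum (λ j → pascal (suc d) (suc j)) p v + binSum (λ j → pascal (suc (suc d)) j) p v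
    ≡⟨ binSum-+ (λ j → pascal (suc d) (suc j)) (pascal (suc (suc d))) p v ⟨
  binSum (λ j → ψ (suc j) (suc d)) p v ∎

paths-afterBlock : ∀ p v u → paths (prefixSums (afterBlock p v)) 0 u ≡ binSum (λ j → ballot (suc j) u) p v
paths-afterBlock p v u = begin
  paths (prefixSums (afterBlock p v)) 0 u            ≡⟨ paths-cong (prefixSums-afterBlock p v) 0 u ⟩
  paths (λ d → binSum (λ j → ψ (suc j) d) p v) 0 u   ≡⟨ paths-binSum (ψ ∘ suc) p v 0 u ⟩
  binSum (λ j → paths (ψ (suc j)) 0 u) p v           ≡⟨ binSum-cong (λ j → paths-ψ≡ballot (suc j) u) p v ⟩
  binSum (λ j → ballot (suc j) u) p v                ∎

-- The term `k = 0` is split off. Pascal's rule divides each other term into one with `j` raised,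
-- which shifts `c`, and one with `j` kept, which raises `s`.
binSum-binomial : ∀ c s v → Σ< (suc v) (λ k → Σ< (suc k) (λ j → (k C j) * (c j * ballot (s + k ∸ j) (v ∸ k)))) ≡ binSum c s v
binSum-binomial c s zero    = begin
  1 * (c 0 * 1) + 0 + 0   ≡⟨ lem (c 0) ⟩
  c 0  ∎
  where
  lem : ∀ x → 1 * (x * 1) + 0 + 0 ≡ x
  lem = solve-∀
binSum-binomial c s (suc v) = begin
  Σ< (2 + v) (λ k → Σ< (suc k) (λ j → (k C j) * F k j))
    ≡⟨ Σ<-suc (suc v) (λ k → Σ< (suc k) (λ j → (k C j) * F k j)) ⟩
  (1 * F 0 0 + 0) + Σ< (suc v) (λ k → Σ< (2 + k) (λ j → (suc k C j) * F (suc k) j))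
    ≡⟨ cong₂ _+_ (trans (+-identityʳ _) (*-identityˡ (F 0 0)))
                 (Σ<-cong (suc v) (λ k _ → Σ<-pascal k (F (suc k)))) ⟩
  F 0 0 + Σ< (suc v) (λ k → Σ< (suc k) (λ j → (k C j) * F (suc k) (suc j)) + Σ< (suc k) (λ j → (k C j) * F (suc k) j))
    ≡⟨ cong₂ _+_ (cong (λ x → c 0 * ballot x (suc v)) (+-identityʳ s)) (Σ<-+ (suc v)
         (λ k → Σ< (suc k) (λ j → (k C j) * F (suc k) (suc j))) (λ k → Σ< (suc k) (λ j → (k C j) * F (suc k) j))) ⟩
  c 0 * ballot s (suc v) + (Σ< (suc v) (λ k → Σ< (suc k) (λ j → (k C j) * F (suc k) (suc j)))
                     + Σ< (suc v) (λ k → Σ< (suc k) (λ j → (k C j) * F (suc k) j)))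
    ≡⟨ cong (c 0 * ballot s (suc v) +_) (cong₂ _+_
         (trans (Σ<-cong (suc v) (λ k _ → Σ<-cong (suc k) (λ j _ → shift₁ k j))) (binSum-binomial (c ∘ suc) s v))
         (trans (Σ<-cong (suc v) (λ k _ → Σ<-cong (suc k) (λ j _ → shift₂ k j))) (binSum-binomial c (suc s) v))) ⟩
  binSum c s (suc v) ∎
  where
  F : ℕ → ℕ → ℕ
  F k j = c j * ballot (s + k ∸ j) (suc v ∸ k)
  shift₁ : ∀ k j → (k C j) * F (suc k) (suc j) ≡ (k C j) * (c (suc j) * ballot (s + k ∸ j) (v ∸ k))
  shift₁ k j = cong (λ x → (k C j) * (c (suc j) * ballot (x ∸ suc j) (v ∸ k))) (+-suc s k)
  shift₂ : ∀ k j → (k C j) * F (suc k) j ≡ (k C j) * (c j * ballot (suc s + k ∸ j) (v ∸ k))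
  shift₂ k j = cong (λ x → (k C j) * (c j * ballot (x ∸ j) (v ∸ k))) (+-suc s k)

-- Queuesort as a one-pass recursion

≡-by-true : ∀ {x y : Bool} → (x ≡ true → y ≡ true) → (y ≡ true → x ≡ true) → x ≡ y
≡-by-true {true}  {y}     f h = sym (f refl)
≡-by-true {false} {true}  f h = h refl
≡-by-true {false} {false} f h = refl

∧-true : ∀ {x y} → x ∧ y ≡ true → x ≡ true × y ≡ true
∧-true {true} {true} _ = refl , refl

not-true : ∀ {x} → not x ≡ true → x ≡ false
not-true {false} _ = refl

<⇒<ᵇ≡true : ∀ {m n} → m < n → (m <ᵇ n) ≡ true
<⇒<ᵇ≡true {zero}  z<s       = refl
<⇒<ᵇ≡true {suc m} (s<s m<n) = <⇒<ᵇ≡true m<n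

≤⇒<ᵇ≡false : ∀ {m n} → n ≤ m → (m <ᵇ n) ≡ false
≤⇒<ᵇ≡false z≤n       = refl
≤⇒<ᵇ≡false (s≤s n≤m) = ≤⇒<ᵇ≡false n≤m

≡ᵇ-refl : ∀ m → (m ≡ᵇ m) ≡ true
≡ᵇ-refl zero    = refl
≡ᵇ-refl (suc m) = ≡ᵇ-refl m

≢⇒≡ᵇ≡false : ∀ {m n} → m ≢ n → (m ≡ᵇ n) ≡ false
≢⇒≡ᵇ≡false {zero}  {zero}  m≢n = contradiction refl m≢n
≢⇒≡ᵇ≡false {zero}  {suc n} m≢n = refl
≢⇒≡ᵇ≡false {suc m} {zero}  m≢n = refl
≢⇒≡ᵇ≡false {suc m} {suc n} m≢n = ≢⇒≡ᵇ≡false (m≢n ∘ cong suc)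

≡ᵇ-true : ∀ {m n} → (m ≡ᵇ n) ≡ true → m ≡ n
≡ᵇ-true {zero}  {zero}  _  = refl
≡ᵇ-true {suc m} {suc n} eq = cong suc (≡ᵇ-true eq)

eqᵇ : List ℕ → List ℕ → Bool
eqᵇ []       []       = true
eqᵇ (x ∷ xs) (y ∷ ys) = (x ≡ᵇ y) ∧ eqᵇ xs ys
eqᵇ _        _        = false

eqᵇ-refl : ∀ xs → eqᵇ xs xs ≡ true
eqᵇ-refl []       = refl
eqᵇ-refl (x ∷ xs) rewrite ≡ᵇ-refl x = eqᵇ-refl xs

eqᵇ-true : ∀ {xs ys} → eqᵇ xs ys ≡ true → xs ≡ ys
eqᵇ-true {[]}     {[]}     _  = refl
eqᵇ-true {x ∷ xs} {y ∷ ys} eq with ∧-true {x ≡ᵇ y} eq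
... | e₁ , e₂ = cong₂ _∷_ (≡ᵇ-true e₁) (eqᵇ-true e₂)

qFrom : ℕ → List ℕ → List ℕ
qFrom c []      = []
qFrom c (y ∷ σ) = if c <ᵇ y then push y (qFrom y σ) else y ∷ qFrom c σ

ltrMaxFrom-above : ∀ c σ → All (c <_) (ltrMaxFrom c σ)
ltrMaxFrom-above c []      = []
ltrMaxFrom-above c (y ∷ σ) with <-≤-connex c y
... | inj₁ c<y rewrite <⇒<ᵇ≡true c<y = c<y ∷ All.map (<-trans c<y) (ltrMaxFrom-above y σ)
... | inj₂ y≤c rewrite ≤⇒<ᵇ≡false y≤c = ltrMaxFrom-above c σ

-- A bubbled entry only moves to the right of where it stands, so bubbling entries other than the
-- head leaves the head in place.
foldr-bubble-∷ : ∀ {y} σ {ms} → All (y <_) ms → foldr bubble (y ∷ σ) ms ≡ y ∷ foldr bubble σ ms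
foldr-bubble-∷ σ []           = refl
foldr-bubble-∷ σ (y<m ∷ y<ms) rewrite foldr-bubble-∷ σ y<ms | ≢⇒≡ᵇ≡false (<⇒≢ y<m) = refl

foldr-bubble≡qFrom : ∀ c σ → foldr bubble σ (ltrMaxFrom c σ) ≡ qFrom c σ
foldr-bubble≡qFrom c []      = refl
foldr-bubble≡qFrom c (y ∷ σ) with <-≤-connex c y
... | inj₁ c<y rewrite <⇒<ᵇ≡true c<y | foldr-bubble-∷ σ (ltrMaxFrom-above y σ) | ≡ᵇ-refl y =
  cong (push y) (foldr-bubble≡qFrom y σ)
... | inj₂ y≤c rewrite ≤⇒<ᵇ≡false y≤c =
  trans (foldr-bubble-∷ σ (All.map (≤-<-trans y≤c) (ltrMaxFrom-above c σ)))
        (cong (y ∷_) (foldr-bubble≡qFrom c σ))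

push-↭ : ∀ y xs → push y xs ↭ y ∷ xs
push-↭ y []       = _↭_.refl
push-↭ y (x ∷ xs) with x <ᵇ y
... | true  = _↭_.trans (prep x (push-↭ y xs)) (swap x y _↭_.refl)
... | false = _↭_.refl

qFrom-↭ : ∀ c σ → qFrom c σ ↭ σ
qFrom-↭ c []      = _↭_.refl
qFrom-↭ c (y ∷ σ) with c <ᵇ y
... | true  = _↭_.trans (push-↭ y _) (prep y (qFrom-↭ y σ))
... | false = prep y (qFrom-↭ c σ)

stops : ℕ → List ℕ → Bool
stops a []      = true
stops a (y ∷ _) = not (y <ᵇ a)

-- Partial inverse of `push a`; `nothing` means that no list is pushed to the target.
pull : ℕ → List ℕ → Maybe (List ℕ)
pull a []      = nothing
pull a (t ∷ T) =
  if t <ᵇ a then Maybe.map (t ∷_) (pull a T) else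
  if (t ≡ᵇ a) ∧ stops a T then just T else nothing

pull-push : ∀ a U → pull a (push a U) ≡ just U
pull-push a [] rewrite ≤⇒<ᵇ≡false (≤-refl {a}) | ≡ᵇ-refl a = refl
pull-push a (u ∷ U) with <-≤-connex u a
... | inj₁ u<a rewrite <⇒<ᵇ≡true u<a | <⇒<ᵇ≡true u<a | pull-push a U = refl
... | inj₂ a≤u rewrite ≤⇒<ᵇ≡false a≤u | ≤⇒<ᵇ≡false (≤-refl {a}) | ≡ᵇ-refl a | ≤⇒<ᵇ≡false a≤u = refl

push-stops : ∀ a T → stops a T ≡ true → push a T ≡ a ∷ T
push-stops a []      _  = refl
push-stops a (y ∷ T) st rewrite not-true {y <ᵇ a} st = refl

push-of-pull : ∀ a T {U} → pull a T ≡ just U → push a U ≡ T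
push-of-pull a (t ∷ T) eq with <-≤-connex t a
... | inj₁ t<a rewrite <⇒<ᵇ≡true t<a with pull a T in eq′ | eq
...   | just U | refl rewrite <⇒<ᵇ≡true t<a = cong (t ∷_) (push-of-pull a T eq′)
push-of-pull a (t ∷ T) eq | inj₂ a≤t rewrite ≤⇒<ᵇ≡false a≤t with t ≡ᵇ a in eq₁ | stops a T in eq₂ | eq
... | true | true | refl = trans (push-stops a T eq₂) (cong (_∷ T) (sym (≡ᵇ-true eq₁)))

eqᵇ-push : ∀ a U T → eqᵇ (push a U) T ≡ maybe′ (eqᵇ U) false (pull a T)
eqᵇ-push a U T = ≡-by-true to from
  where
  to : eqᵇ (push a U) T ≡ true → maybe′ (eqᵇ U) false (pull a T) ≡ true
  to eq rewrite sym (eqᵇ-true {push a U} {T} eq) | pull-push a U = eqᵇ-refl U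
  from : maybe′ (eqᵇ U) false (pull a T) ≡ true → eqᵇ (push a U) T ≡ true
  from eq with pull a T in eq′
  ... | just U′ rewrite eqᵇ-true {U} {U′} eq | push-of-pull a T eq′ = eqᵇ-refl T

pull-just : ∀ {a X Y} → All (_< a) X → stops a Y ≡ true → pull a (X ++ a ∷ Y) ≡ just (X ++ Y)
pull-just {a} [] st rewrite ≤⇒<ᵇ≡false (≤-refl {a}) | ≡ᵇ-refl a | st = refl
pull-just (x<a ∷ X<a) st rewrite <⇒<ᵇ≡true x<a = cong (Maybe.map _) (pull-just X<a st)

pull-skip : ∀ {a} X {Z} → a ∉ X → pull a Z ≡ nothing → pull a (X ++ Z) ≡ nothing
pull-skip []      a∉X eq = eq
pull-skip {a} (x ∷ X) a∉X eq rewrite ≢⇒≡ᵇ≡false (λ x≡a → a∉X (here (sym x≡a))) with x <ᵇ a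
... | true  = cong (Maybe.map _) (pull-skip X (a∉X ∘ there) eq)
... | false = refl

pull-∉ : ∀ {a} X → a ∉ X → pull a X ≡ nothing
pull-∉ {a} X a∉X = trans (cong (pull a) (sym (++-identityʳ X))) (pull-skip X a∉X refl)

-- A letter below `z` is stopped at `z`; `z` itself fails because a smaller entry follows it; a
-- letter above `z` is above all of `P`, so it could only be found in `Z`.
pull-blocked : ∀ {a z P Z} → P ≢ [] → All (_< z) P → pull a Z ≡ nothing → pull a (z ∷ P ++ Z) ≡ nothing
pull-blocked {P = []} P≢[] _ _ = contradiction refl P≢[]
pull-blocked {a} {z} {p ∷ P} {Z} _ P<z@(p<z ∷ _) eq with <-cmp z a
... | tri< z<a _ _ rewrite <⇒<ᵇ≡true z<a =
  cong (Maybe.map (z ∷_)) (pull-skip (p ∷ P) {Z} (λ a∈P → <-asym z<a (All.lookup P<z a∈P)) eq)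
... | tri≈ _ refl _ rewrite ≤⇒<ᵇ≡false (≤-refl {z}) | ≡ᵇ-refl z | <⇒<ᵇ≡true p<z = refl
... | tri> _ _ a<z rewrite ≤⇒<ᵇ≡false (<⇒≤ a<z) | ≢⇒≡ᵇ≡false (>⇒≢ a<z) = refl

-- Counting the words with a given image

count : {A : Set} → (A → Bool) → List A → ℕ
count p xs = length (boolFilter p xs)

module _ {A : Set} where

  count-cong : ∀ {p r : A → Bool} xs → (∀ {x} → x ∈ xs → p x ≡ r x) → count p xs ≡ count r xs
  count-cong []       eq = refl
  count-cong {p} {r} (x ∷ xs) eq rewrite eq (here refl) with r x
  ... | true  = cong suc (count-cong xs (eq ∘ there))
  ... | false = count-cong xs (eq ∘ there)

  count-false : ∀ xs → count {A} (λ _ → false) xs ≡ 0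
  count-false []       = refl
  count-false (x ∷ xs) = count-false xs

  count-++ : ∀ (p : A → Bool) xs ys → count p (xs ++ ys) ≡ count p xs + count p ys
  count-++ p []       ys = refl
  count-++ p (x ∷ xs) ys with p x
  ... | true  = cong suc (count-++ p xs ys)
  ... | false = count-++ p xs ys

  count-boolFilter : ∀ (p r : A → Bool) xs → count p (boolFilter r xs) ≡ count (λ x → r x ∧ p x) xs
  count-boolFilter p r []       = refl
  count-boolFilter p r (x ∷ xs) with r x
  ... | false = count-boolFilter p r xs
  ... | true with p x
  ...   | true  = cong suc (count-boolFilter p r xs)
  ...   | false = count-boolFilter p r xs

count-map : ∀ {A B : Set} (p : B → Bool) (f : A → B) xs → count p (map f xs) ≡ count (p ∘ f) xs
count-map p f []       = refl
count-map p f (x ∷ xs) with p (f x)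
... | true  = cong suc (count-map p f xs)
... | false = count-map p f xs

count-concatMap : ∀ {A B : Set} (p : B → Bool) (f : A → List B) xs →
                  count p (concatMap f xs) ≡ sum (map (count p ∘ f) xs)
count-concatMap p f []       = refl
count-concatMap p f (x ∷ xs) =
  trans (count-++ p (f x) (concatMap f xs)) (cong (count p (f x) +_) (count-concatMap p f xs))

-- Sums over the alphabet and strictly increasing lists

range : ℕ → ℕ → List ℕ
range c zero    = []
range c (suc k) = suc c ∷ range (suc c) k

applyUpTo≡range : ∀ f c k → (∀ i → f i ≡ suc (c + i)) → applyUpTo f k ≡ range c k
applyUpTo≡range f c zero    eq = refl
applyUpTo≡range f c (suc k) eq =
  cong₂ _∷_ (trans (eq 0) (cong suc (+-identityʳ c)))
            (applyUpTo≡range (f ∘ suc) (suc c) k (λ i → trans (eq (suc i)) (cong suc (+-suc c i))))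

map-suc-upTo : ∀ n → map suc (upTo n) ≡ range 0 n
map-suc-upTo n = trans (map-upTo suc n) (applyUpTo≡range suc 0 n (λ _ → refl))

count-words : ∀ (p : List ℕ → Bool) k n →
              count p (words (suc k) n) ≡ sum (map (λ a → count (p ∘ (a ∷_)) (words k n)) (range 0 n))
count-words p k n = begin
  count p (words (suc k) n)
    ≡⟨ count-concatMap p (λ a → map (a ∷_) (words k n)) (map suc (upTo n)) ⟩
  sum (map (λ a → count p (map (a ∷_) (words k n))) (map suc (upTo n)))
    ≡⟨ cong sum (map-cong (λ a → count-map p (a ∷_) (words k n)) (map suc (upTo n))) ⟩
  sum (map (λ a → count (p ∘ (a ∷_)) (words k n)) (map suc (upTo n)))
    ≡⟨ cong (λ as → sum (map (λ a → count (p ∘ (a ∷_)) (words k n)) as)) (map-suc-upTo n) ⟩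
  sum (map (λ a → count (p ∘ (a ∷_)) (words k n)) (range 0 n)) ∎

linked-above : ∀ {c U} → Linked _<_ (c ∷ U) → All (c <_) U
linked-above [-]       = []
linked-above (c<u ∷ l) = c<u ∷ All.map (<-trans c<u) (linked-above l)

linked-split : ∀ {c a} U {V} → Linked _<_ (c ∷ U ++ a ∷ V) → c < a × All (_< a) U × Linked _<_ (a ∷ V)
linked-split []      (c<a ∷ l) = c<a , [] , l
linked-split (u ∷ U) (c<u ∷ l) with linked-split U l
... | u<a , U<a , l′ = <-trans c<u u<a , u<a ∷ U<a , l′

linked-lower : ∀ {c b U} → c ≤ b → Linked _<_ (b ∷ U) → Linked _<_ (c ∷ U)
linked-lower c≤b [-]       = [-]
linked-lower c≤b (b<u ∷ l) = ≤-<-trans c≤b b<u ∷ l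

linked-stops : ∀ {a V} → Linked _<_ (a ∷ V) → stops a V ≡ true
linked-stops [-]       = refl
linked-stops (a<v ∷ l) rewrite ≤⇒<ᵇ≡false (<⇒≤ a<v) = refl

split-All : ∀ {P : ℕ → Set} A U₁ {a U₂} → All P (A ++ U₁ ++ a ∷ U₂) → All P ((A ++ U₁) ++ U₂)
split-All A U₁ {a} {U₂} p rewrite ++-assoc A U₁ U₂ =
  ++⁺ (++⁻ˡ A p) (++⁺ (++⁻ˡ U₁ (++⁻ʳ A p)) (All.tail (++⁻ʳ U₁ (++⁻ʳ A p))))

length-remove : ∀ {k} (X : List ℕ) a Y → length (X ++ a ∷ Y) ≡ suc k → length (X ++ Y) ≡ k
length-remove X a Y eq = suc-injective (trans (sym (length-++-sucʳ X a Y)) eq)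

sum-zero : ∀ (h : ℕ → ℕ) xs → (∀ {x} → x ∈ xs → h x ≡ 0) → sum (map h xs) ≡ 0
sum-zero h []       eq = refl
sum-zero h (x ∷ xs) eq rewrite eq (here refl) = sum-zero h xs (eq ∘ there)

range-above : ∀ c k {x} → x ∈ range c k → c < x
range-above c (suc k) (here refl) = ≤-refl
range-above c (suc k) (there x∈)  = <-trans ≤-refl (range-above (suc c) k x∈)

-- Cuts the sum over all first letters down to the possible ones, by matching the increasing list
-- `E` against the interval letter by letter.
sum-support : ∀ (h : ℕ → ℕ) c k E → Linked _<_ (c ∷ E) → All (_≤ c + k) E →
              (∀ a → c < a → a ∉ E → h a ≡ 0) → sum (map h (range c k)) ≡ sum (map h E)
sum-support h c k       []      l           E≤     z = sum-zero h (range c k) (λ x∈ → z _ (range-above c k x∈) λ ())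
sum-support h c zero    (a ∷ E) (c<a ∷ _)   (a≤ ∷ _) z =
  contradiction (<-≤-trans c<a (≤-trans a≤ (≤-reflexive (+-identityʳ c)))) (<-irrefl refl)
sum-support h c (suc k) (a ∷ E) (c<a ∷ l)   (a≤ ∷ E≤) z with m≤n⇒m<n∨m≡n c<a
... | inj₂ refl = cong (h (suc c) +_) $
  sum-support h (suc c) k E l (subst (λ m → All (_≤ m) E) (+-suc c k) E≤)
    (λ x c<x x∉E → z x (<-trans ≤-refl c<x) λ { (here refl) → <-irrefl refl c<x ; (there x∈E) → x∉E x∈E })
... | inj₁ sc<a = trans (cong (_+ sum (map h (range (suc c) k))) (z (suc c) ≤-refl sc∉))
    (sum-support h (suc c) k (a ∷ E) (sc<a ∷ l) (subst (λ m → All (_≤ m) (a ∷ E)) (+-suc c k) (a≤ ∷ E≤))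
      (λ x c<x → z x (<-trans ≤-refl c<x)))
  where
  sc∉ : suc c ∉ a ∷ E
  sc∉ x∈ = <-irrefl refl (All.lookup (linked-above (sc<a ∷ l)) x∈)

-- Choosing `a` makes the entries `U₁` before it pending and leaves `U₂`, so the choices run along
-- one diagonal of states.
sum-Σdiag : ∀ (h : ℕ → ℕ) f d U → (∀ U₁ a U₂ → U ≡ U₁ ++ a ∷ U₂ → h a ≡ f (d + length U₁) (length U₂)) →
            sum (map h U) ≡ Σdiag f d (length U)
sum-Σdiag h f d []      eq = refl
sum-Σdiag h f d (a ∷ U) eq = cong₂ _+_
  (trans (eq [] a U refl) (cong (λ m → f m (length U)) (+-identityʳ d)))
  (sum-Σdiag h f (suc d) U λ U₁ b U₂ e →
    trans (eq (a ∷ U₁) b U₂ (cong (a ∷_) e)) (cong (λ m → f m (length U₂)) (+-suc d (length U₁))))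

-- Recursion on the first letter

module _ (n : ℕ) where

  Entry : ℕ → Set
  Entry x = 0 < x × x ≤ n

  -- The count runs over all words on the alphabet; if `T` has no repeated entries, `distinct-qFrom`
  -- shows that only words with distinct letters contribute. The predicate `r` serves to prescribe
  -- the position of the largest entry.
  fibre : ℕ → ℕ → List ℕ → (List ℕ → Bool) → ℕ
  fibre k c T r = count (λ σ → eqᵇ (qFrom c σ) T ∧ r σ) (words k n)

  starting : ℕ → ℕ → List ℕ → (List ℕ → Bool) → ℕ → ℕ
  starting k c T r a = count (λ σ → eqᵇ (qFrom c (a ∷ σ)) T ∧ r (a ∷ σ)) (words k n)

  starting-above : ∀ k {c a} T r → c < a →
                   starting k c T r a ≡ maybe′ (λ U → fibre k a U (r ∘ (a ∷_))) 0 (pull a T)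
  starting-above k {c} {a} T r c<a rewrite <⇒<ᵇ≡true c<a =
    trans (count-cong (words k n) (λ {σ} _ → cong (_∧ r (a ∷ σ)) (eqᵇ-push a (qFrom a σ) T))) (lem (pull a T))
    where
    lem : ∀ m → count (λ σ → maybe′ (eqᵇ (qFrom a σ)) false m ∧ r (a ∷ σ)) (words k n)
              ≡ maybe′ (λ U → fibre k a U (r ∘ (a ∷_))) 0 m
    lem (just U) = refl
    lem nothing  = count-false (words k n)

  starting-below-≡ : ∀ k {c t} T r → t ≤ c → starting k c (t ∷ T) r t ≡ fibre k c T (r ∘ (t ∷_))
  starting-below-≡ k {c} {t} T r t≤c rewrite ≤⇒<ᵇ≡false t≤c | ≡ᵇ-refl t = refl

  starting-below-≢ : ∀ k {c a t} T r → a ≤ c → a ≢ t → starting k c (t ∷ T) r a ≡ 0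
  starting-below-≢ k {c} {t} T r a≤c a≢t rewrite ≤⇒<ᵇ≡false a≤c | ≢⇒≡ᵇ≡false a≢t = count-false (words k n)

  starting-below-[] : ∀ k {c a} r → a ≤ c → starting k c [] r a ≡ 0
  starting-below-[] k r a≤c rewrite ≤⇒<ᵇ≡false a≤c = count-false (words k n)

  -- The contribution of a first letter at most `c`, which must be the head of the target; there is
  -- none when `A` is empty.
  pending : ℕ → ℕ → List ℕ → List ℕ → (List ℕ → Bool) → ℕ
  pending k c []      V r = 0
  pending k c (t ∷ A) V r = fibre k c (A ++ V) (r ∘ (t ∷_))

  -- E lists the letters that can occur next as a left-to-right maximum.
  fibre-step : ∀ k c A V r E → All Entry A → All (_≤ c) A → (∀ {x W} → V ≡ x ∷ W → c < x) →
               Linked _<_ (c ∷ E) → All (_≤ n) E → (∀ {a} → c < a → a ∉ E → pull a (A ++ V) ≡ nothing) →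
               fibre (suc k) c (A ++ V) r ≡ pending k c A V r + sum (map (starting k c (A ++ V) r) E)
  fibre-step k c A V r E entA A≤c c<V l E≤n none =
    trans (count-words (λ σ → eqᵇ (qFrom c σ) (A ++ V) ∧ r σ) k n) (lem A entA A≤c none)
    where
    zero-above : ∀ T → (∀ {a} → c < a → a ∉ E → pull a T ≡ nothing) → ∀ {a} → c < a → a ∉ E → starting k c T r a ≡ 0
    zero-above T none {a} c<a a∉E =
      trans (starting-above k T r c<a) (cong (maybe′ (λ U → fibre k a U (r ∘ (a ∷_))) 0) (none c<a a∉E))
    zero-below : ∀ V → (∀ {x W} → V ≡ x ∷ W → c < x) → ∀ {a} → a ≤ c → starting k c V r a ≡ 0
    zero-below []      c<V a≤c = starting-below-[] k r a≤c
    zero-below (x ∷ V) c<V a≤c = starting-below-≢ k V r a≤c (<⇒≢ (≤-<-trans a≤c (c<V refl)))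
    lem : ∀ A → All Entry A → All (_≤ c) A → (∀ {a} → c < a → a ∉ E → pull a (A ++ V) ≡ nothing) →
          sum (map (starting k c (A ++ V) r) (range 0 n)) ≡ pending k c A V r + sum (map (starting k c (A ++ V) r) E)
    lem [] _ _ none = sum-support (starting k c V r) 0 n E (linked-lower z≤n l) E≤n z
      where
      z : ∀ a → 0 < a → a ∉ E → starting k c V r a ≡ 0
      z a _ a∉E with <-≤-connex c a
      ... | inj₁ c<a = zero-above V none c<a a∉E
      ... | inj₂ a≤c = zero-below V c<V a≤c
    -- Among the letters up to `c` only `t` can come first, so it joins `E`, all of which lies above
    -- `c`.
    lem (t ∷ A) ((0<t , t≤n) ∷ _) (t≤c ∷ _) none =
      trans (sum-support (starting k c (t ∷ A ++ V) r) 0 n (t ∷ E) (0<t ∷ linked-lower t≤c l) (t≤n ∷ E≤n) z)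
            (cong (_+ sum (map (starting k c (t ∷ A ++ V) r) E)) (starting-below-≡ k (A ++ V) r t≤c))
      where
      z : ∀ a → 0 < a → a ∉ t ∷ E → starting k c (t ∷ A ++ V) r a ≡ 0
      z a _ a∉E with <-≤-connex c a
      ... | inj₁ c<a = zero-above (t ∷ A ++ V) none c<a (a∉E ∘ there)
      ... | inj₂ a≤c = starting-below-≢ k (A ++ V) r a≤c (a∉E ∘ here)

  starting-remove : ∀ k {c a} X Y r → c < a → All (_< a) X → stops a Y ≡ true →
                    starting k c (X ++ a ∷ Y) r a ≡ fibre k a (X ++ Y) (r ∘ (a ∷_))
  starting-remove k {c} {a} X Y r c<a X<a st =
    trans (starting-above k (X ++ a ∷ Y) r c<a)
          (cong (maybe′ (λ U → fibre k a U (r ∘ (a ∷_))) 0) (pull-just X<a st))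

-- Targets with an increasing tail

module _ (n : ℕ) where

  -- Induction on the word length. Each entry of the increasing list `U` is removable, and removing
  -- it makes the entries of `U` before it pending; `Σdiag-ballot` sums these choices.
  fibre-increasing : ∀ k c A U → length (A ++ U) ≡ k → All (Entry n) (A ++ U) → All (_≤ c) A →
                     Linked _<_ (c ∷ U) → fibre n k c (A ++ U) (λ _ → true) ≡ ballot (length A) (length U)
  fibre-increasing zero    c []      []      len ent A≤c l = refl
  fibre-increasing (suc k) c A       U       len ent A≤c l = begin
    fibre n (suc k) c (A ++ U) (λ _ → true)
      ≡⟨ fibre-step n k c A U (λ _ → true) U (++⁻ˡ A ent) A≤c (λ { refl → All.head (linked-above l) }) l
           (All.map proj₂ (++⁻ʳ A ent))
           (λ c<a a∉U → pull-∉ (A ++ U)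
             (λ a∈ → [ (λ a∈A → <⇒≱ c<a (All.lookup A≤c a∈A)) , a∉U ]′ (∈-++⁻ A a∈))) ⟩
    pending n k c A U (λ _ → true) + sum (map (starting n k c (A ++ U) (λ _ → true)) U)
      ≡⟨ cong (pending n k c A U (λ _ → true) +_) (sum-Σdiag _ ballot (length A) U removed) ⟩
    pending n k c A U (λ _ → true) + Σdiag ballot (length A) (length U)
      ≡⟨ pend A U len ent A≤c l ⟩
    ballot (length A) (length U) ∎
    where
    removed : ∀ U₁ a U₂ → U ≡ U₁ ++ a ∷ U₂ →
              starting n k c (A ++ U) (λ _ → true) a ≡ ballot (length A + length U₁) (length U₂)
    removed U₁ a U₂ refl with linked-split U₁ l
    ... | c<a , U₁<a , l′ = begin
      starting n k c (A ++ U₁ ++ a ∷ U₂) (λ _ → true) a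
        ≡⟨ cong (λ T → starting n k c T (λ _ → true) a) (++-assoc A U₁ (a ∷ U₂)) ⟨
      starting n k c ((A ++ U₁) ++ a ∷ U₂) (λ _ → true) a
        ≡⟨ starting-remove n k (A ++ U₁) U₂ (λ _ → true) c<a AU₁<a (linked-stops l′) ⟩
      fibre n k a ((A ++ U₁) ++ U₂) (λ _ → true)
        ≡⟨ fibre-increasing k a (A ++ U₁) U₂
             (length-remove (A ++ U₁) a U₂ (trans (cong length (++-assoc A U₁ (a ∷ U₂))) len))
             (split-All A U₁ ent) (All.map <⇒≤ AU₁<a) l′ ⟩
      ballot (length (A ++ U₁)) (length U₂)
        ≡⟨ cong (λ m → ballot m (length U₂)) (length-++ A) ⟩
      ballot (length A + length U₁) (length U₂) ∎
      where
      AU₁<a : All (_< a) (A ++ U₁)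
      AU₁<a = ++⁺ (All.map (λ x≤c → ≤-<-trans x≤c c<a) A≤c) U₁<a
    pend : ∀ A U → length (A ++ U) ≡ suc k → All (Entry n) (A ++ U) → All (_≤ c) A → Linked _<_ (c ∷ U) →
           pending n k c A U (λ _ → true) + Σdiag ballot (length A) (length U) ≡ ballot (length A) (length U)
    pend []      (u ∷ U) len ent       A≤c       l = Σdiag-ballot 0 (length U)
    pend (t ∷ A) U       len (_ ∷ ent) (_ ∷ A≤c) l
      rewrite fibre-increasing k c A U (suc-injective len) ent A≤c l with U
    ... | []     = refl
    ... | u ∷ U′ = cong (ballot (length A) (length (u ∷ U′)) +_) (Σdiag-ballot (suc (length A)) (length U′))

-- Targets with one block

linked-drop : ∀ {c z} B {D} → Linked _<_ (c ∷ B ++ z ∷ D) → Linked _<_ (c ∷ B ++ D)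
linked-drop []      (c<z ∷ l) = linked-lower (<⇒≤ c<z) l
linked-drop (b ∷ B) (c<b ∷ l) = c<b ∷ linked-drop B l

module _ (n : ℕ) where

  -- A first letter is the head of `A`, or an entry of `B`, which leaves a target of the same shape,
  -- or an entry of `d ∷ D`, after which all that precedes it is pending and `fibre-increasing`
  -- applies. The last contribution depends only on `length A + length B`, so `paths-step` closes
  -- the recursion.
  fibre-blocked : ∀ {z P d D} → P ≢ [] → All (_< z) P → ∀ k c A B →
                  let T = A ++ B ++ z ∷ P ++ d ∷ D in
                  length T ≡ k → All (Entry n) T → All (_≤ c) A → Linked _<_ (c ∷ B ++ z ∷ d ∷ D) →
                  fibre n k c T (λ _ → true) ≡ paths (prefixSums (afterBlock (length P) (length D))) (length A) (length B)
  fibre-blocked P≢[] P<z zero c []      []      ()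
  fibre-blocked P≢[] P<z zero c []      (_ ∷ _) ()
  fibre-blocked P≢[] P<z zero c (_ ∷ _) _       ()
  fibre-blocked {z} {P} {d} {D′} P≢[] P<z (suc k) c A B len ent A≤c l = begin
    fibre n (suc k) c T r
      ≡⟨ fibre-step n k c A (B ++ Z) r (B ++ D) (++⁻ˡ A ent) A≤c (above B l) (linked-drop B l)
           (All.map proj₂ (++⁺ (++⁻ˡ B entB) (++⁻ʳ P (All.tail (++⁻ʳ B entB))))) none ⟩
    pending n k c A (B ++ Z) r + sum (map h (B ++ D))
      ≡⟨ cong (λ xs → pending n k c A (B ++ Z) r + sum xs) (map-++ h B D) ⟩
    pending n k c A (B ++ Z) r + sum (map h B ++ map h D)
      ≡⟨ cong (pending n k c A (B ++ Z) r +_) (sum-++ (map h B) (map h D)) ⟩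
    pending n k c A (B ++ Z) r + (sum (map h B) + sum (map h D))
      ≡⟨ cong₂ (λ x y → pending n k c A (B ++ Z) r + (x + y))
           (sum-Σdiag h F (length A) B removedB)
           (trans (sum-Σdiag h ballot (length X) D removedD) tailD) ⟩
    pending n k c A (B ++ Z) r + (Σdiag F (length A) (length B) + afterBlock p v (length A + length B))
      ≡⟨ cong (_+ (Σdiag F (length A) (length B) + afterBlock p v (length A + length B))) (pend A len ent A≤c) ⟩
    atPred (λ d → F d (length B)) (length A) + (Σdiag F (length A) (length B) + afterBlock p v (length A + length B))
      ≡⟨ paths-step (afterBlock p v) (length A) (length B) ⟨
    F (length A) (length B) ∎
    where
    D = d ∷ D′
    Z = z ∷ P ++ D
    T = A ++ B ++ Z
    X = A ++ B ++ z ∷ P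
    p = length P
    v = length D′
    F = paths (prefixSums (afterBlock p v))
    r : List ℕ → Bool
    r _ = true
    h = starting n k c T r
    entB : All (Entry n) (B ++ Z)
    entB = ++⁻ʳ A ent
    above : ∀ B → Linked _<_ (c ∷ B ++ z ∷ D) → ∀ {x W} → B ++ Z ≡ x ∷ W → c < x
    above []      (c<z ∷ _) refl = c<z
    above (b ∷ B) (c<b ∷ _) refl = c<b
    none : ∀ {a} → c < a → a ∉ B ++ D → pull a T ≡ nothing
    none {a} c<a a∉ = pull-skip A (λ a∈A → <⇒≱ c<a (All.lookup A≤c a∈A))
      (pull-skip B (a∉ ∘ ∈-++⁺ˡ)
        (pull-blocked {a} {z} {P} {D} P≢[] P<z (pull-∉ D (a∉ ∘ ∈-++⁺ʳ B))))
    removedB : ∀ U₁ a U₂ → B ≡ U₁ ++ a ∷ U₂ → h a ≡ F (length A + length U₁) (length U₂)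
    removedB U₁ a U₂ refl with linked-split U₁ (subst (λ U → Linked _<_ (c ∷ U)) (++-assoc U₁ (a ∷ U₂) (z ∷ D)) l)
    ... | c<a , U₁<a , l′ = begin
      h a
        ≡⟨ cong (λ T → starting n k c T r a) assoc ⟩
      starting n k c ((A ++ U₁) ++ a ∷ U₂ ++ Z) r a
        ≡⟨ starting-remove n k (A ++ U₁) (U₂ ++ Z) r c<a AU₁<a (st U₂ l′) ⟩
      fibre n k a ((A ++ U₁) ++ U₂ ++ Z) r
        ≡⟨ fibre-blocked P≢[] P<z k a (A ++ U₁) U₂
             (length-remove (A ++ U₁) a (U₂ ++ Z) (trans (cong length (sym assoc)) len))
             (split-All A U₁ (subst (λ U → All (Entry n) (A ++ U)) (++-assoc U₁ (a ∷ U₂) Z) ent))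
             (All.map <⇒≤ AU₁<a) l′ ⟩
      F (length (A ++ U₁)) (length U₂)
        ≡⟨ cong (λ m → F m (length U₂)) (length-++ A) ⟩
      F (length A + length U₁) (length U₂) ∎
      where
      assoc : T ≡ (A ++ U₁) ++ a ∷ U₂ ++ Z
      assoc = trans (cong (A ++_) (++-assoc U₁ (a ∷ U₂) Z)) (sym (++-assoc A U₁ (a ∷ U₂ ++ Z)))
      AU₁<a : All (_< a) (A ++ U₁)
      AU₁<a = ++⁺ (All.map (λ x≤c → ≤-<-trans x≤c c<a) A≤c) U₁<a
      st : ∀ U → Linked _<_ (a ∷ U ++ z ∷ D) → stops a (U ++ Z) ≡ true
      -- `stops` inspects the head alone, so the chain that passes over `P` suffices.
      st []      l@(_ ∷ _) = linked-stops {V = z ∷ D} l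
      st (u ∷ U) l         = linked-stops l
    removedD : ∀ D₁ a D₂ → D ≡ D₁ ++ a ∷ D₂ → h a ≡ ballot (length X + length D₁) (length D₂)
    removedD D₁ a D₂ eq with linked-split B l
    ... | c<z , B<z , l₁ with linked-split D₁ (subst (λ U → Linked _<_ (z ∷ U)) eq l₁)
    ...   | z<a , D₁<a , l₂ = begin
      h a
        ≡⟨ cong (λ T → starting n k c T r a) assoc ⟩
      starting n k c ((X ++ D₁) ++ a ∷ D₂) r a
        ≡⟨ starting-remove n k (X ++ D₁) D₂ r (<-trans c<z z<a) XD₁<a (linked-stops l₂) ⟩
      fibre n k a ((X ++ D₁) ++ D₂) r
        ≡⟨ fibre-increasing n k a (X ++ D₁) D₂
             (length-remove (X ++ D₁) a D₂ (trans (cong length (sym assoc)) len))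
             (split-All X D₁ (subst (All (Entry n)) (trans assoc (++-assoc X D₁ (a ∷ D₂))) ent))
             (All.map <⇒≤ XD₁<a) l₂ ⟩
      ballot (length (X ++ D₁)) (length D₂)
        ≡⟨ cong (λ m → ballot m (length D₂)) (length-++ X) ⟩
      ballot (length X + length D₁) (length D₂) ∎
      where
      assoc : T ≡ (X ++ D₁) ++ a ∷ D₂
      assoc = begin
        A ++ B ++ z ∷ P ++ D            ≡⟨ cong (λ D → A ++ B ++ z ∷ P ++ D) eq ⟩
        A ++ B ++ (z ∷ P) ++ D₁ ++ a ∷ D₂ ≡⟨ cong (A ++_) (++-assoc B (z ∷ P) (D₁ ++ a ∷ D₂)) ⟨
        A ++ (B ++ z ∷ P) ++ D₁ ++ a ∷ D₂ ≡⟨ ++-assoc A (B ++ z ∷ P) (D₁ ++ a ∷ D₂) ⟨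
        X ++ D₁ ++ a ∷ D₂                 ≡⟨ ++-assoc X D₁ (a ∷ D₂) ⟨
        (X ++ D₁) ++ a ∷ D₂ ∎
      XD₁<a : All (_< a) (X ++ D₁)
      XD₁<a = ++⁺ (++⁺ (All.map (λ x≤c → ≤-<-trans x≤c (<-trans c<z z<a)) A≤c)
                       (++⁺ (All.map (λ x<z → <-trans x<z z<a) B<z) (z<a ∷ All.map (λ x<z → <-trans x<z z<a) P<z)))
                  D₁<a
    tailD : Σdiag ballot (length X) (length D) ≡ afterBlock p v (length A + length B)
    tailD = trans (Σdiag-ballot (length X) v) (cong (λ m → ballot m v)
      (trans (cong suc (trans (length-++ A) (cong (length A +_) (length-++ B))))
             (arith (length A) (length B) p)))
      where
      arith : ∀ a b p → suc (a + (b + suc p)) ≡ 2 + (a + b + p)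
      arith = solve-∀
    pend : ∀ A → length (A ++ B ++ Z) ≡ suc k → All (Entry n) (A ++ B ++ Z) → All (_≤ c) A →
           pending n k c A (B ++ Z) r ≡ atPred (λ d → F d (length B)) (length A)
    pend []      len ent       A≤c       = refl
    pend (t ∷ A) len (_ ∷ ent) (_ ∷ A≤c) = fibre-blocked P≢[] P<z k c A B (suc-injective len) ent A≤c l

-- Positions of the largest entry; the state (d , u) has u + 1 entries above the current maximum.
maxAt : ℕ → ℕ → ℕ → ℕ
maxAt zero          d u = 0
maxAt (suc zero)    d u = 1
maxAt (suc (suc i)) d u = atPred (λ d → maxAt (suc i) d u) d + Σdiag (maxAt (suc i)) d u

Σdiag-zero : ∀ {f} i → (∀ d u → d + u ≤ i → f d u ≡ 0) → ∀ d u → d + u ≤ suc i → Σdiag f d u ≡ 0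
Σdiag-zero i z d zero    _  = refl
Σdiag-zero i z d (suc u) le =
  cong₂ _+_ (z d u (s≤s⁻¹ le′)) (Σdiag-zero i z (suc d) u le′)
  where
  le′ : suc (d + u) ≤ suc i
  le′ = ≤-trans (≤-reflexive (sym (+-suc d u))) le

-- Words from the state `(d , u)` have `d + u + 1` letters, so position `2 + i` lies beyond their
-- end.
maxAt-zero : ∀ i d u → d + u ≤ i → maxAt (2 + i) d u ≡ 0
maxAt-zero zero    zero    zero    _  = refl
maxAt-zero (suc i) zero    u       le = Σdiag-zero i (maxAt-zero i) zero u le
maxAt-zero (suc i) (suc d) u       le =
  cong₂ _+_ (maxAt-zero i d u (s≤s⁻¹ le)) (Σdiag-zero i (maxAt-zero i) (suc d) u le)

-- Only the largest entry is above the current maximum; it can be read after any number of the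
-- pending entries, and each position arises from exactly one word.
maxAt-one : ∀ i d → i ≤ d → maxAt (suc i) d 0 ≡ 1
maxAt-one zero    d       _        = refl
maxAt-one (suc i) (suc d) (s≤s le) = trans (+-identityʳ _) (maxAt-one i d le)

Σdiag-one : ∀ d u → Σdiag (λ _ _ → 1) d u ≡ u
Σdiag-one d zero    = refl
Σdiag-one d (suc u) = cong suc (Σdiag-one (suc d) u)

-- Induction on the position trades the sum along a diagonal for a relation between neighbouring
-- positions, which is the ballot recursion in disguise. The bound keeps position `2 + i` inside the
-- words counted on the left.
maxAt-rec : ∀ i d u → i ≤ d + u → maxAt (2 + i) d (suc u) ≡ maxAt (2 + i) d u + maxAt (1 + i) d (suc u)
maxAt-rec zero    d u _  = begin
  atPred (λ _ → 1) d + (1 + Σdiag (λ _ _ → 1) (suc d) u)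
    ≡⟨ cong (λ x → atPred (λ _ → 1) d + (1 + x)) (trans (Σdiag-one (suc d) u) (sym (Σdiag-one d u))) ⟩
  atPred (λ _ → 1) d + (1 + Σdiag (λ _ _ → 1) d u)
    ≡⟨ lem (atPred (λ _ → 1) d) (Σdiag (λ _ _ → 1) d u) ⟩
  atPred (λ _ → 1) d + Σdiag (λ _ _ → 1) d u + 1 ∎
  where
  lem : ∀ a b → a + (1 + b) ≡ a + b + 1
  lem = solve-∀
maxAt-rec (suc i) d u le =
  trans (cong₂ _+_ (pred-rec d u le) (diag-rec d u le))
        (interchange (atPred (λ d → f d u) d) _ (Σdiag f d u) _)
  where
  f = maxAt (2 + i)
  f′ = maxAt (1 + i)
  pred-rec : ∀ d u → suc i ≤ d + u →
             atPred (λ d → f d (suc u)) d ≡ atPred (λ d → f d u) d + atPred (λ d → f′ d (suc u)) d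
  pred-rec zero    u le = refl
  pred-rec (suc d) u le = maxAt-rec i d u (s≤s⁻¹ le)
  diag-rec : ∀ d u → suc i ≤ d + u → Σdiag f d (suc u) ≡ Σdiag f d u + Σdiag f′ d (suc u)
  -- Here the diagonals have a single term, and both terms are 1.
  diag-rec d zero    le = cong (_+ 0) (trans (maxAt-one (suc i) d le′) (sym (maxAt-one i d (<⇒≤ le′))))
    where
    le′ : suc i ≤ d
    le′ = ≤-trans le (≤-reflexive (+-identityʳ d))
  diag-rec d (suc u) le =
    trans (cong₂ _+_ (maxAt-rec i d u (s≤s⁻¹ le′)) (diag-rec (suc d) u le′))
          (interchange (f d u) _ (Σdiag f (suc d) u) _)
    where
    le′ : suc i ≤ suc d + u
    le′ = ≤-trans le (≤-reflexive (+-suc d u))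

maxAt≡ballot : ∀ d u → maxAt (suc u) 0 (d + u) ≡ ballot d u
maxAt≡ballot d       zero    = refl
-- The first summand asks for a position beyond the end of the word, which yields the one-term case
-- of `ballot` at height 0.
maxAt≡ballot zero    (suc u) = trans (maxAt-rec u 0 u ≤-refl) (cong₂ _+_ (maxAt-zero u 0 u ≤-refl) (maxAt≡ballot 1 u))
maxAt≡ballot (suc d) (suc u) = trans (maxAt-rec u 0 (d + suc u) (≤-trans (n≤1+n u) (m≤n+m (suc u) d)))
  (cong₂ _+_ (maxAt≡ballot d (suc u))
             (trans (cong (λ m → maxAt (suc u) 0 (suc m)) (+-suc d u)) (maxAt≡ballot (suc (suc d)) u)))

isJust≡-entry : ∀ i σ {M} → isJust≡ (entry i σ) M ≡ true → M ∈ σ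
isJust≡-entry (suc zero)    (x ∷ σ) eq = here (sym (≡ᵇ-true eq))
isJust≡-entry (suc (suc i)) (x ∷ σ) eq = there (isJust≡-entry (suc i) σ eq)

module _ (n : ℕ) where

  fibre-false : ∀ k c T r → (∀ σ → eqᵇ (qFrom c σ) T ≡ true → r σ ≡ false) → fibre n k c T r ≡ 0
  fibre-false k c T r z = trans (count-cong (words k n) (λ {σ} _ → lem σ)) (count-false (words k n))
    where
    lem : ∀ σ → eqᵇ (qFrom c σ) T ∧ r σ ≡ false
    lem σ with eqᵇ (qFrom c σ) T in eq
    ... | true  = z σ eq
    ... | false = refl

  fibre-absent : ∀ k c T i {M} → M ∉ T → fibre n k c T (λ σ → isJust≡ (entry i σ) M) ≡ 0
  fibre-absent k c T i {M} M∉T = fibre-false k c T _ z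
    where
    z : ∀ σ → eqᵇ (qFrom c σ) T ≡ true → isJust≡ (entry i σ) M ≡ false
    z σ eq with isJust≡ (entry i σ) M in eq′
    ... | false = refl
    ... | true  = contradiction
      (subst (M ∈_) (eqᵇ-true {qFrom c σ} eq) (∈-resp-↭ (↭-sym (qFrom-↭ c σ)) (isJust≡-entry i σ eq′))) M∉T

  starting-≢ : ∀ k c T {a M} → a ≢ M → starting n k c T (λ σ → isJust≡ (entry 1 σ) M) a ≡ 0
  starting-≢ k c T {a} {M} a≢M = trans (count-cong (words k n) (λ {σ} _ → lem σ)) (count-false (words k n))
    where
    lem : ∀ σ → eqᵇ (qFrom c (a ∷ σ)) T ∧ (a ≡ᵇ M) ≡ false
    lem σ rewrite ≢⇒≡ᵇ≡false a≢M = ∧-zeroʳ _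

  -- The analysis of `fibre-increasing` with the position of `M` followed along. If `M` is read
  -- first, the rest is forced when position 1 is asked for; for a later position nothing is
  -- counted, since `M` has left the target.
  fibre-maxAt : ∀ i k c A U {M} → let T = A ++ U ++ M ∷ [] in
                length T ≡ k → All (Entry n) T → All (_≤ c) A → Linked _<_ (c ∷ U ++ M ∷ []) →
                fibre n k c T (λ σ → isJust≡ (entry (suc i) σ) M) ≡ maxAt (suc i) (length A) (length U)
  fibre-maxAt i zero    c []      []      ()
  fibre-maxAt i zero    c []      (_ ∷ _) ()
  fibre-maxAt i zero    c (_ ∷ _) _       ()
  fibre-maxAt i (suc k) c A U {M} len ent A≤c l = begin
    fibre n (suc k) c T (r i)
      ≡⟨ fibre-step n k c A V (r i) V (++⁻ˡ A ent) A≤c (λ eq → head-above (subst (λ V → Linked _<_ (c ∷ V)) eq l)) l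
           (All.map proj₂ (++⁻ʳ A ent))
           (λ c<a a∉V → pull-∉ T (λ a∈ → [ (λ a∈A → <⇒≱ c<a (All.lookup A≤c a∈A)) , a∉V ]′ (∈-++⁻ A a∈))) ⟩
    pending n k c A V (r i) + sum (map (h i) V)
      ≡⟨ cong (λ xs → pending n k c A V (r i) + sum xs) (map-++ (h i) U (M ∷ [])) ⟩
    pending n k c A V (r i) + sum (map (h i) U ++ h i M ∷ [])
      ≡⟨ cong (pending n k c A V (r i) +_) (sum-++ (map (h i) U) (h i M ∷ [])) ⟩
    pending n k c A V (r i) + (sum (map (h i) U) + (h i M + 0))
      ≡⟨ cong (λ x → pending n k c A V (r i) + (sum (map (h i) U) + x)) (trans (+-identityʳ _) (removedM i)) ⟩
    pending n k c A V (r i) + (sum (map (h i) U) + fibre n k M (A ++ U) (r i ∘ (M ∷_)))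
      ≡⟨ parts i ⟩
    maxAt (suc i) (length A) (length U) ∎
    where
    V = U ++ M ∷ []
    T = A ++ V
    r : ℕ → List ℕ → Bool
    r i σ = isJust≡ (entry (suc i) σ) M
    h : ℕ → ℕ → ℕ
    h i = starting n k c T (r i)
    head-above : ∀ {x W} → Linked _<_ (c ∷ x ∷ W) → c < x
    head-above (c<x ∷ _) = c<x
    c<M : c < M
    c<M = proj₁ (linked-split U l)
    U<M : All (_< M) U
    U<M = proj₁ (proj₂ (linked-split U l))
    A<M : All (_< M) A
    A<M = All.map (λ x≤c → ≤-<-trans x≤c c<M) A≤c
    assoc : T ≡ (A ++ U) ++ M ∷ []
    assoc = sym (++-assoc A U (M ∷ []))
    removedM : ∀ i → h i M ≡ fibre n k M (A ++ U) (r i ∘ (M ∷_))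
    removedM i = begin
      h i M                                          ≡⟨ cong (λ T → starting n k c T (r i) M) assoc ⟩
      starting n k c ((A ++ U) ++ M ∷ []) (r i) M    ≡⟨ starting-remove n k (A ++ U) [] (r i) c<M (++⁺ A<M U<M) refl ⟩
      fibre n k M ((A ++ U) ++ []) (r i ∘ (M ∷_))    ≡⟨ cong (λ T → fibre n k M T (r i ∘ (M ∷_))) (++-identityʳ (A ++ U)) ⟩
      fibre n k M (A ++ U) (r i ∘ (M ∷_))            ∎
    removed : ∀ i U₁ a U₂ → U ≡ U₁ ++ a ∷ U₂ → h (suc i) a ≡ maxAt (suc i) (length A + length U₁) (length U₂)
    removed i U₁ a U₂ refl with linked-split U₁ (subst (λ U → Linked _<_ (c ∷ U)) (++-assoc U₁ (a ∷ U₂) (M ∷ [])) l)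
    ... | c<a , U₁<a , l′ = begin
      h (suc i) a
        ≡⟨ cong (λ T → starting n k c T (r (suc i)) a) assoc′ ⟩
      starting n k c ((A ++ U₁) ++ a ∷ U₂ ++ M ∷ []) (r (suc i)) a
        ≡⟨ starting-remove n k (A ++ U₁) (U₂ ++ M ∷ []) (r (suc i)) c<a AU₁<a (linked-stops l′) ⟩
      fibre n k a ((A ++ U₁) ++ U₂ ++ M ∷ []) (r i)
        ≡⟨ fibre-maxAt i k a (A ++ U₁) U₂
             (length-remove (A ++ U₁) a (U₂ ++ M ∷ []) (trans (cong length (sym assoc′)) len))
             (split-All A U₁ (subst (λ U → All (Entry n) (A ++ U)) (++-assoc U₁ (a ∷ U₂) (M ∷ [])) ent))
             (All.map <⇒≤ AU₁<a) l′ ⟩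
      maxAt (suc i) (length (A ++ U₁)) (length U₂)
        ≡⟨ cong (λ m → maxAt (suc i) m (length U₂)) (length-++ A) ⟩
      maxAt (suc i) (length A + length U₁) (length U₂) ∎
      where
      assoc′ : T ≡ (A ++ U₁) ++ a ∷ U₂ ++ M ∷ []
      assoc′ = trans (cong (A ++_) (++-assoc U₁ (a ∷ U₂) (M ∷ []))) (sym (++-assoc A U₁ (a ∷ U₂ ++ M ∷ [])))
      AU₁<a : All (_< a) (A ++ U₁)
      AU₁<a = ++⁺ (All.map (λ x≤c → ≤-<-trans x≤c c<a) A≤c) U₁<a
    pend-zero : ∀ A → All (_< M) A → pending n k c A V (r 0) ≡ 0
    pend-zero []      _         = refl
    pend-zero (t ∷ A) (t<M ∷ _) = fibre-false k c (A ++ V) _ (λ _ _ → ≢⇒≡ᵇ≡false (<⇒≢ t<M))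
    pend-suc : ∀ i A → length (A ++ V) ≡ suc k → All (Entry n) (A ++ V) → All (_≤ c) A →
               pending n k c A V (r (suc i)) ≡ atPred (λ d → maxAt (suc i) d (length U)) (length A)
    pend-suc i []      len ent       A≤c       = refl
    pend-suc i (t ∷ A) len (_ ∷ ent) (_ ∷ A≤c) = fibre-maxAt i k c A U (suc-injective len) ent A≤c l
    parts : ∀ i → pending n k c A V (r i) + (sum (map (h i) U) + fibre n k M (A ++ U) (r i ∘ (M ∷_)))
          ≡ maxAt (suc i) (length A) (length U)
    parts zero = cong₂ _+_ (pend-zero A A<M)
      (cong₂ _+_ (sum-zero (h 0) U (λ a∈U → starting-≢ k c T (<⇒≢ (All.lookup U<M a∈U)))) one)
      where
      one : fibre n k M (A ++ U) (λ _ → M ≡ᵇ M) ≡ 1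
      one rewrite ≡ᵇ-refl M | sym (++-identityʳ (A ++ U)) =
        fibre-increasing n k M (A ++ U) []
          (length-remove (A ++ U) M [] (trans (cong length (sym assoc)) len))
          (split-All A U ent)
          (All.map <⇒≤ (++⁺ A<M U<M)) [-]
    parts (suc i) = cong₂ _+_ (pend-suc i A len ent A≤c)
      (trans (cong₂ _+_ (sum-Σdiag (h (suc i)) (maxAt (suc i)) (length A) U (removed i))
                        (fibre-absent k M (A ++ U) (suc i) (λ M∈ → <-irrefl refl (All.lookup (++⁺ A<M U<M) M∈))))
             (+-identityʳ _))

-- 321-avoiding permutations

words-∈ : ∀ k n {σ} → σ ∈ words k n → length σ ≡ k × All (Entry n) σ
words-∈ zero    n (here refl) = refl , []
words-∈ (suc k) n σ∈ with ∈-concatMap⁻ (λ a → map (a ∷_) (words k n)) {xs = map suc (upTo n)} σ∈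
... | any′ with find any′
... | a , a∈ , σ∈′ with ∈-map⁻ (a ∷_) σ∈′ | ∈-map⁻ suc a∈
...   | σ , σ∈w , refl | i , i∈ , refl with words-∈ k n σ∈w
...     | len , ent = cong suc len , (z<s , ∈-upTo⁻ i∈) ∷ ent

boolFilter-∈ : ∀ {A : Set} (p : A → Bool) xs {x} → x ∈ boolFilter p xs → x ∈ xs × p x ≡ true
boolFilter-∈ p (x ∷ xs) x∈ with p x in eq
boolFilter-∈ p (x ∷ xs) (here refl) | true = here refl , eq
boolFilter-∈ p (x ∷ xs) (there x∈) | true with boolFilter-∈ p xs x∈
... | x∈′ , px = there x∈′ , px
boolFilter-∈ p (x ∷ xs) x∈ | false with boolFilter-∈ p xs x∈
... | x∈′ , px = there x∈′ , px

notIn-true : ∀ {x} xs → notIn x xs ≡ true → All (x ≢_) xs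
notIn-true []       _  = []
notIn-true {x} (y ∷ xs) eq with ∧-true {not (x ≡ᵇ y)} eq
... | e₁ , e₂ = x≢y ∷ notIn-true xs e₂
  where
  x≢y : x ≢ y
  x≢y refl rewrite ≡ᵇ-refl x = contradiction e₁ λ ()

All-notIn : ∀ {x xs} → All (x ≢_) xs → notIn x xs ≡ true
All-notIn []          = refl
All-notIn (x≢y ∷ all) rewrite ≢⇒≡ᵇ≡false x≢y = All-notIn all

distinct⇒Unique : ∀ xs → distinct xs ≡ true → Unique xs
distinct⇒Unique []       _  = []
distinct⇒Unique (x ∷ xs) eq with ∧-true {notIn x xs} eq
... | e₁ , e₂ = notIn-true xs e₁ ∷ distinct⇒Unique xs e₂

Unique⇒distinct : ∀ {xs} → Unique xs → distinct xs ≡ true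
Unique⇒distinct []        = refl
Unique⇒distinct (x∉ ∷ u) rewrite All-notIn x∉ = Unique⇒distinct u

Unique-resp-↭ : ∀ {xs ys : List ℕ} → xs ↭ ys → Unique xs → Unique ys
Unique-resp-↭ p = Permₛ.Unique-resp-↭ (setoid ℕ) (↭⇒↭ₛ p)

distinct-qFrom : ∀ c σ {T} → eqᵇ (qFrom c σ) T ≡ true → Unique T → distinct σ ≡ true
distinct-qFrom c σ eq u = Unique⇒distinct
  (Unique-resp-↭ (qFrom-↭ c σ) (subst Unique (sym (eqᵇ-true {qFrom c σ} eq)) u))

any-below-false : ∀ {y} σ → any (_<ᵇ y) σ ≡ false → All (y ≤_) σ
any-below-false []      _  = []
any-below-false {y} (x ∷ σ) eq with <-≤-connex x y
... | inj₁ x<y rewrite <⇒<ᵇ≡true x<y = contradiction eq λ ()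
... | inj₂ y≤x rewrite ≤⇒<ᵇ≡false y≤x = y≤x ∷ any-below-false σ eq

All-any-below : ∀ {y σ} → All (y ≤_) σ → any (_<ᵇ y) σ ≡ false
All-any-below []          = refl
All-any-below (y≤x ∷ all) rewrite ≤⇒<ᵇ≡false y≤x = All-any-below all

All-has21below : ∀ {y σ} → All (y ≤_) σ → has21below y σ ≡ false
All-has21below []          = refl
All-has21below (y≤x ∷ all) rewrite ≤⇒<ᵇ≡false y≤x = All-has21below all

∨-false : ∀ {x y} → x ∨ y ≡ false → x ≡ false × y ≡ false
∨-false {false} eq = refl , eq

has21below-mono : ∀ {c y} σ → c ≤ y → has21below y σ ≡ false → has21below c σ ≡ false
has21below-mono []      c≤y eq = refl
has21below-mono {c} {y} (x ∷ σ) c≤y eq with ∨-false {(x <ᵇ y) ∧ any (_<ᵇ x) σ} eq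
... | e₁ , e₂ rewrite has21below-mono σ c≤y e₂ with <-≤-connex x c
...   | inj₂ c≤x rewrite ≤⇒<ᵇ≡false c≤x = refl
...   | inj₁ x<c rewrite <⇒<ᵇ≡true x<c | <⇒<ᵇ≡true (<-≤-trans x<c c≤y) | e₁ = refl

Sorted : List ℕ → Set
Sorted = AllPairs _≤_

push-Sorted : ∀ y {U} → Sorted U → Sorted (push y U)
push-Sorted y []               = [] ∷ []
push-Sorted y {u ∷ U} (u≤ ∷ s) with <-≤-connex u y
... | inj₁ u<y rewrite <⇒<ᵇ≡true u<y = All-resp-↭ (↭-sym (push-↭ y U)) (<⇒≤ u<y ∷ u≤) ∷ push-Sorted y s
... | inj₂ y≤u rewrite ≤⇒<ᵇ≡false y≤u = (y≤u ∷ All.map (≤-trans y≤u) u≤) ∷ u≤ ∷ s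

unpush-Sorted : ∀ y U → Sorted (push y U) → Sorted U
unpush-Sorted y []      _ = []
unpush-Sorted y (u ∷ U) s with u <ᵇ y
unpush-Sorted y (u ∷ U) (u≤ ∷ s) | true  = All.tail (All-resp-↭ (push-↭ y U) u≤) ∷ unpush-Sorted y U s
unpush-Sorted y (u ∷ U) (_ ∷ s)  | false = s

-- The current maximum `c` in front of `σ` stands for all letters read so far as the top of a
-- pattern. A letter below `c` has nothing smaller after it, so it can be output at once.
avoids321⇒Sorted : ∀ c σ → Unique (c ∷ σ) → avoids321 (c ∷ σ) ≡ true → Sorted (qFrom c σ)
avoids321⇒Sorted c []      _ _ = []
avoids321⇒Sorted c (y ∷ σ) ((c≢y ∷ c∉σ) ∷ u@(_ ∷ uσ)) av
  with ∧-true {not (has21below c (y ∷ σ))} av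
... | no21 , avy with ∨-false {(y <ᵇ c) ∧ any (_<ᵇ y) σ} (not-true no21)
...   | e₁ , e₂ with <-≤-connex c y
...     | inj₁ c<y rewrite <⇒<ᵇ≡true c<y = push-Sorted y (avoids321⇒Sorted y σ u avy)
...     | inj₂ y≤c rewrite ≤⇒<ᵇ≡false y≤c | <⇒<ᵇ≡true (≤∧≢⇒< y≤c (c≢y ∘ sym)) =
  All-resp-↭ (↭-sym (qFrom-↭ c σ)) (any-below-false σ e₁) ∷ avoids321⇒Sorted c σ (c∉σ ∷ uσ) avc
  where
  avc : avoids321 (c ∷ σ) ≡ true
  avc rewrite e₂ = proj₂ (∧-true {not (has21below y σ)} avy)

-- If `y` is output at once, no later letter is smaller, so `y` is neither the top nor the middle of
-- a pattern. If `y` is enqueued, a pattern with top `c` would give one with top `y`, by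
-- `has21below-mono`.
Sorted⇒avoids321 : ∀ c σ → Sorted (qFrom c σ) → avoids321 (c ∷ σ) ≡ true
Sorted⇒avoids321 c []      _ = refl
Sorted⇒avoids321 c (y ∷ σ) s with <-≤-connex c y
... | inj₁ c<y rewrite <⇒<ᵇ≡true c<y | ≤⇒<ᵇ≡false (<⇒≤ c<y) = lem (Sorted⇒avoids321 y σ (unpush-Sorted y (qFrom y σ) s))
  where
  lem : avoids321 (y ∷ σ) ≡ true → not (has21below c σ) ∧ avoids321 (y ∷ σ) ≡ true
  lem av rewrite has21below-mono σ (<⇒≤ c<y) (not-true (proj₁ (∧-true {not (has21below y σ)} av))) = av
Sorted⇒avoids321 c (y ∷ σ) s | inj₂ y≤c rewrite ≤⇒<ᵇ≡false y≤c with s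
... | y≤ ∷ s′ with All-resp-↭ (qFrom-↭ c σ) y≤
...   | y≤σ rewrite All-any-below y≤σ | All-has21below y≤σ | ∧-zeroʳ (y <ᵇ c) = Sorted⇒avoids321 c σ s′

range-length : ∀ c k → length (range c k) ≡ k
range-length c zero    = refl
range-length c (suc k) = cong suc (range-length (suc c) k)

range-last : ∀ c k → range c (suc k) ≡ range c k ++ suc (c + k) ∷ []
range-last c zero    = cong (λ m → suc m ∷ []) (sym (+-identityʳ c))
range-last c (suc k) = cong (suc c ∷_)
  (trans (range-last (suc c) k) (cong (λ m → range (suc c) k ++ suc m ∷ []) (sym (+-suc c k))))

range-linked : ∀ c k → Linked _<_ (c ∷ range c k)
range-linked c zero    = [-]
range-linked c (suc k) = ≤-refl ∷ range-linked (suc c) k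

range-≤ : ∀ c k → All (_≤ c + k) (range c k)
range-≤ c zero    = []
range-≤ c (suc k) = subst (λ m → All (_≤ m) (range c (suc k))) (sym (+-suc c k))
  (s≤s (m≤m+n c k) ∷ range-≤ (suc c) k)

linked≡range : ∀ c k T → length T ≡ k → Linked _<_ (c ∷ T) → All (_≤ c + k) T → T ≡ range c k
linked≡range c zero    []      _   _ _ = refl
linked≡range c (suc k) (t ∷ T) len l@(c<t ∷ l′) (t≤ ∷ T≤) with m≤n⇒m<n∨m≡n c<t
... | inj₂ refl = cong (suc c ∷_)
  (linked≡range (suc c) k T (suc-injective len) l′ (subst (λ m → All (_≤ m) T) (+-suc c k) T≤))
-- Skipping `suc c` would leave only `k` values for `suc k` increasing entries.
... | inj₁ c+1<t = contradiction (overflow (t ∷ T) len (c+1<t ∷ l′) (t≤ ∷ T≤)) λ ()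
  where
  overflow : ∀ {c k} T → length T ≡ suc k → Linked _<_ (suc c ∷ T) → All (_≤ c + suc k) T → ⊥
  overflow {c} {zero}  (t ∷ [])    len (c<t ∷ _) (t≤ ∷ _) =
    <⇒≱ c<t (≤-trans t≤ (≤-reflexive (+-comm c 1)))
  overflow {c} {suc k} (t ∷ s ∷ T) len (c<t ∷ l) (_ ∷ T≤) =
    overflow {suc c} {k} (s ∷ T) (suc-injective len) (linked-lower c<t l)
             (subst (λ m → All (_≤ m) (s ∷ T)) (+-suc c (suc k)) T≤)

Sorted∧Unique⇒strict : ∀ {T} → Sorted T → Unique T → AllPairs _<_ T
Sorted∧Unique⇒strict s u = AllPairs.zipWith (λ (x≤y , x≢y) → ≤∧≢⇒< x≤y x≢y) (s , u)

-- On words with distinct letters, avoiding 321 means being sorted by Queuesort. The initial maximum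
-- 0 is below every letter and so creates no pattern.
b≡fibre : ∀ n i → b n i ≡ fibre n n 0 (range 0 n) (λ σ → isJust≡ (entry i σ) n)
b≡fibre n i =
  trans (count-boolFilter (λ σ → avoids321 σ ∧ isJust≡ (entry i σ) n) distinct (words n n))
        (count-cong (words n n) (λ {σ} σ∈ → ≡-by-true (to σ σ∈) (from σ σ∈)))
  where
  to : ∀ σ → σ ∈ words n n → distinct σ ∧ (avoids321 σ ∧ isJust≡ (entry i σ) n) ≡ true →
       eqᵇ (qFrom 0 σ) (range 0 n) ∧ isJust≡ (entry i σ) n ≡ true
  to σ σ∈ eq with ∧-true {distinct σ} eq | words-∈ n n σ∈
  ... | d , eq′ | len , ent with ∧-true {avoids321 σ} eq′
  ...   | av , e = lem
    where
    uσ : Unique σ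
    uσ = distinct⇒Unique σ d
    av₀ : avoids321 (0 ∷ σ) ≡ true
    av₀ rewrite All-has21below {0} {σ} (All.map (λ _ → z≤n) ent) = av
    sorted : Sorted (qFrom 0 σ)
    sorted = avoids321⇒Sorted 0 σ (All.map (λ x → <⇒≢ (proj₁ x)) ent ∷ uσ) av₀
    perm : σ ↭ qFrom 0 σ
    perm = ↭-sym (qFrom-↭ 0 σ)
    ent′ : All (Entry n) (qFrom 0 σ)
    ent′ = All-resp-↭ perm ent
    is-range : qFrom 0 σ ≡ range 0 n
    is-range = linked≡range 0 n (qFrom 0 σ) (trans (sym (↭-length perm)) len)
      (AllPairs⇒Linked (All.map proj₁ ent′ ∷ Sorted∧Unique⇒strict sorted (Unique-resp-↭ perm uσ)))
      (All.map proj₂ ent′)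
    lem : eqᵇ (qFrom 0 σ) (range 0 n) ∧ isJust≡ (entry i σ) n ≡ true
    lem rewrite is-range | eqᵇ-refl (range 0 n) = e
  strict : AllPairs _<_ (range 0 n)
  strict = AllPairs.tail (Linked⇒AllPairs <-trans (range-linked 0 n))
  from : ∀ σ → σ ∈ words n n → eqᵇ (qFrom 0 σ) (range 0 n) ∧ isJust≡ (entry i σ) n ≡ true →
         distinct σ ∧ (avoids321 σ ∧ isJust≡ (entry i σ) n) ≡ true
  from σ σ∈ eq with ∧-true {eqᵇ (qFrom 0 σ) (range 0 n)} eq
  ... | is-range , e rewrite distinct-qFrom 0 σ is-range (AllPairs.map <⇒≢ strict) | e
    | proj₂ (∧-true {not (has21below 0 σ)} (Sorted⇒avoids321 0 σ
        (subst Sorted (sym (eqᵇ-true {qFrom 0 σ} is-range)) (AllPairs.map <⇒≤ strict)))) = refl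

b≡maxAt : ∀ n i → b (suc n) (suc i) ≡ maxAt (suc i) 0 n
b≡maxAt n i = begin
  b (suc n) (suc i)
    ≡⟨ b≡fibre (suc n) (suc i) ⟩
  fibre (suc n) (suc n) 0 (range 0 (suc n)) r
    ≡⟨ cong (λ T → fibre (suc n) (suc n) 0 T r) (range-last 0 n) ⟩
  fibre (suc n) (suc n) 0 T r
    ≡⟨ fibre-maxAt (suc n) i (suc n) 0 [] (range 0 n) (subst (λ T → length T ≡ suc n) (range-last 0 n) (range-length 0 (suc n)))
         (subst (All (Entry (suc n))) (range-last 0 n)
           (All.zip (linked-above (range-linked 0 (suc n)) , range-≤ 0 (suc n))))
         [] (subst (λ T → Linked _<_ (0 ∷ T)) (range-last 0 n) (range-linked 0 (suc n))) ⟩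
  maxAt (suc i) 0 (length (range 0 n))
    ≡⟨ cong (maxAt (suc i) 0) (range-length 0 n) ⟩
  maxAt (suc i) 0 n ∎
  where
  r : List ℕ → Bool
  r σ = isJust≡ (entry (suc i) σ) (suc n)
  T = range 0 n ++ suc n ∷ []

b≡ballot : ∀ d u → b (suc (d + u)) (suc u) ≡ ballot d u
b≡ballot d u = trans (b≡maxAt (d + u) u) (maxAt≡ballot d u)

-- The double sum of the theorem in ballot numbers

formula≡binSum : ∀ u p v → formula (suc u) p (suc v) ≡ binSum (λ j → ballot (suc j) u) p v
formula≡binSum u p v = trans
  (Σ<-cong (suc v) (λ k k<1+v → Σ<-cong (suc k) (λ j j<1+k → term k j (s≤s⁻¹ k<1+v) (s≤s⁻¹ j<1+k))))
  (binSum-binomial (λ j → ballot (suc j) u) p v)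
  where
  term : ∀ k j → k ≤ v → j ≤ k →
         (k C j) * b (suc u + j + 1) (suc u) * b (suc v + p ∸ j) (v ∸ k + 1)
         ≡ (k C j) * (ballot (suc j) u * ballot (p + k ∸ j) (v ∸ k))
  -- Writing `k = j + x` and `v = k + w` makes every truncated subtraction exact and brings both
  -- factors into the form of `b≡ballot`.
  term k j k≤v j≤k with m≤n⇒∃[o]m+o≡n j≤k
  ... | x , refl with m≤n⇒∃[o]m+o≡n k≤v
  ...   | w , refl = trans (*-assoc ((j + x) C j) _ _) (cong (((j + x) C j) *_) (cong₂ _*_ first second))
    where
    first : b (suc u + j + 1) (suc u) ≡ ballot (suc j) u
    first = trans (cong (λ m → b m (suc u)) (arith u j)) (b≡ballot (suc j) u)
      where
      arith : ∀ u j → suc u + j + 1 ≡ suc (suc j + u)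
      arith = solve-∀
    second : b (suc (j + x + w) + p ∸ j) (j + x + w ∸ (j + x) + 1) ≡ ballot (p + (j + x) ∸ j) (j + x + w ∸ (j + x))
    second = begin
      b (suc (j + x + w) + p ∸ j) (j + x + w ∸ (j + x) + 1)
        ≡⟨ cong₂ b (trans (cong (_∸ j) (arith₁ j x w p)) (m+n∸m≡n j _)) (trans (+-comm _ 1) (cong suc (m+n∸m≡n (j + x) w))) ⟩
      b (suc (p + x + w)) (suc w)
        ≡⟨ b≡ballot (p + x) w ⟩
      ballot (p + x) w
        ≡⟨ cong₂ ballot (trans (cong (_∸ j) (arith₂ p j x)) (m+n∸m≡n j _)) (m+n∸m≡n (j + x) w) ⟨
      ballot (p + (j + x) ∸ j) (j + x + w ∸ (j + x)) ∎
      where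
      arith₁ : ∀ j x w p → suc (j + x + w) + p ≡ j + suc (p + x + w)
      arith₁ = solve-∀
      arith₂ : ∀ p j x → p + (j + x) ≡ j + (p + x)
      arith₂ = solve-∀

-- Preimages under Queuesort

-- The equality test of qPreimage is local to its where block and cannot be named here;
-- the underscores are solved by it through unification, abstracting the target as w
-- because the test is lifted over n and π.
mutual
  length-qPreimage : ∀ n π → length (qPreimage n π) ≡ count (λ σ → eqᵇ (q σ) π) (S n)
  length-qPreimage n π = count-cong (S n) (λ {σ} _ → listEq-q≡eqᵇ n π σ)

  listEq-q≡eqᵇ : ∀ n π σ → _ ≡ eqᵇ (q σ) π
  listEq-q≡eqᵇ n π σ with q σ
  listEq-q≡eqᵇ n []      σ | []     = refl
  listEq-q≡eqᵇ n (_ ∷ _) σ | []     = refl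
  listEq-q≡eqᵇ n []      σ | _ ∷ _  = refl
  listEq-q≡eqᵇ n (y ∷ π) σ | x ∷ xs with y ∷ π
  ... | w = cong ((x ≡ᵇ y) ∧_) (listEq≡eqᵇ n w xs π)

  listEq≡eqᵇ : ∀ n (w xs ys : List ℕ) → _ ≡ eqᵇ xs ys
  listEq≡eqᵇ n w []       []       = refl
  listEq≡eqᵇ n w []       (_ ∷ _)  = refl
  listEq≡eqᵇ n w (_ ∷ _)  []       = refl
  listEq≡eqᵇ n w (x ∷ xs) (y ∷ ys) = cong ((x ≡ᵇ y) ∧_) (listEq≡eqᵇ n w xs ys)

-- Counting permutations and counting all words agree, because a word that reaches a target without
-- repeated entries has distinct letters.
qPreimage≡fibre : ∀ n π → Unique π → length (qPreimage n π) ≡ fibre n n 0 π (λ _ → true)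
qPreimage≡fibre n π uπ = begin
  length (qPreimage n π)
    ≡⟨ length-qPreimage n π ⟩
  count (λ σ → eqᵇ (q σ) π) (S n)
    ≡⟨ count-boolFilter (λ σ → eqᵇ (q σ) π) distinct (words n n) ⟩
  count (λ σ → distinct σ ∧ eqᵇ (q σ) π) (words n n)
    ≡⟨ count-cong (words n n) (λ {σ} _ → lem σ) ⟩
  fibre n n 0 π (λ _ → true) ∎
  where
  lem : ∀ σ → distinct σ ∧ eqᵇ (q σ) π ≡ eqᵇ (qFrom 0 σ) π ∧ true
  lem σ rewrite foldr-bubble≡qFrom 0 σ | ∧-identityʳ (eqᵇ (qFrom 0 σ) π) = ≡-by-true
    (λ eq → proj₂ (∧-true {distinct σ} eq))
    (λ eq → cong₂ _∧_ (distinct-qFrom 0 σ eq uπ) eq)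

-- The shape of the target read off its left-to-right maxima

ltrMaxFrom-∈ : ∀ c σ {x} → x ∈ ltrMaxFrom c σ → x ∈ σ
ltrMaxFrom-∈ c (y ∷ σ) x∈ with c <ᵇ y
ltrMaxFrom-∈ c (y ∷ σ) (here refl) | true  = here refl
ltrMaxFrom-∈ c (y ∷ σ) (there x∈)  | true  = there (ltrMaxFrom-∈ y σ x∈)
ltrMaxFrom-∈ c (y ∷ σ) x∈          | false = there (ltrMaxFrom-∈ c σ x∈)

-- Were `m` at most `c`, the first maximum listed would be a second copy of `m` inside `R`.
ltrMaxFrom-head : ∀ c m R {W} → All (m ≢_) R → ltrMaxFrom c (m ∷ R) ≡ m ∷ W → c < m × ltrMaxFrom m R ≡ W
ltrMaxFrom-head c m R m∉R eq with <-≤-connex c m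
... | inj₁ c<m rewrite <⇒<ᵇ≡true c<m = c<m , ∷-injectiveʳ eq
... | inj₂ m≤c rewrite ≤⇒<ᵇ≡false m≤c =
  contradiction refl (All.lookup m∉R (ltrMaxFrom-∈ c R (subst (m ∈_) (sym eq) (here refl))))

-- An entry of `P` above `c` would be listed as a maximum and hence occur again in `D`.
ltrMaxFrom-block : ∀ c P D → Unique (P ++ D) → ltrMaxFrom c (P ++ D) ≡ D → All (_≤ c) P × Linked _<_ (c ∷ D)
ltrMaxFrom-block c []      []      _       _  = [] , [-]
ltrMaxFrom-block c []      (d ∷ D) (d∉ ∷ u) eq with ltrMaxFrom-head c d D d∉ eq
... | c<d , eq′ = [] , c<d ∷ proj₂ (ltrMaxFrom-block d [] D u eq′)
ltrMaxFrom-block c (p ∷ P) D       (p∉ ∷ u) eq with <-≤-connex c p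
... | inj₁ c<p rewrite <⇒<ᵇ≡true c<p =
  contradiction refl (All.lookup p∉ (∈-++⁺ʳ P (subst (p ∈_) eq (here refl))))
... | inj₂ p≤c rewrite ≤⇒<ᵇ≡false p≤c with ltrMaxFrom-block c P D u eq
...   | P≤c , l = p≤c ∷ P≤c , l

-- `z` is the last entry of the initial run. No entry of `P` is a maximum, so all of `P` lies below
-- `z`, which is the shape that `fibre-blocked` asks for.
ltrMaxFrom-decomposition : ∀ c m M P D → Unique (m ∷ M ++ P ++ D) → ltrMaxFrom c (m ∷ M ++ P ++ D) ≡ m ∷ M ++ D →
  ∃₂ λ B z → m ∷ M ≡ B ++ z ∷ [] × All (_< z) P × Linked _<_ (c ∷ B ++ z ∷ D)
ltrMaxFrom-decomposition c m []       P D (m∉ ∷ u) eq with ltrMaxFrom-head c m (P ++ D) m∉ eq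
... | c<m , eq′ with ltrMaxFrom-block m P D u eq′
...   | P≤m , l = [] , m , refl , All.zipWith (λ (p≤m , m≢p) → ≤∧≢⇒< p≤m (m≢p ∘ sym)) (P≤m , ++⁻ˡ P m∉) , c<m ∷ l
ltrMaxFrom-decomposition c m (m′ ∷ M) P D (m∉ ∷ u) eq with ltrMaxFrom-head c m (m′ ∷ M ++ P ++ D) m∉ eq
... | c<m , eq′ with ltrMaxFrom-decomposition m m′ M P D u eq′
...   | B , z , split , P<z , l = m ∷ B , z , cong (m ∷_) split , P<z , c<m ∷ l

theorem4p18 : (n : ℕ) (π : List ℕ) → π ∈ S n →
    (M₁ P₁ M₂ : List ℕ) → π ≡ M₁ ++ P₁ ++ M₂ → ltrMaxima π ≡ M₁ ++ M₂ →
    P₁ ≢ [] → M₂ ≢ [] →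
    length (qPreimage n π) ≡ formula (length M₁) (length P₁) (length M₂)
theorem4p18 n π π∈S M₁ P [] _ _ _ M₂≢[] = contradiction refl M₂≢[]
theorem4p18 n π π∈S M₁ P (d ∷ D) π≡ ltr≡ P≢[] _ with boolFilter-∈ distinct (words n n) π∈S
... | π∈w , dπ with words-∈ n n π∈w
theorem4p18 n π π∈S [] [] (d ∷ D) _ _ P≢[] _ | _ | _ = contradiction refl P≢[]
-- With an empty initial run the first entry would be at most the starting maximum 0.
theorem4p18 n _ π∈S [] P@(p ∷ _) (d ∷ D) refl ltr≡ P≢[] _ | π∈w , dπ | len , ((0<p , _) ∷ _)
  with ltrMaxFrom-block 0 P (d ∷ D) (distinct⇒Unique _ dπ) ltr≡
... | (p≤0 ∷ _) , _ = contradiction 0<p (≤⇒≯ p≤0)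
theorem4p18 n _ π∈S (m ∷ M) P (d ∷ D) refl ltr≡ P≢[] _ | π∈w , dπ | len , ent
  with ltrMaxFrom-decomposition 0 m M P (d ∷ D) (distinct⇒Unique _ dπ) ltr≡
... | B , z , split , P<z , l = begin
  length (qPreimage n ((m ∷ M) ++ P ++ d ∷ D))
    ≡⟨ qPreimage≡fibre n _ (distinct⇒Unique _ dπ) ⟩
  fibre n n 0 ((m ∷ M) ++ P ++ d ∷ D) (λ _ → true)
    ≡⟨ cong (λ T → fibre n n 0 T (λ _ → true)) π≡ ⟩
  fibre n n 0 (B ++ z ∷ P ++ d ∷ D) (λ _ → true)
    ≡⟨ fibre-blocked n P≢[] P<z n 0 [] B (trans (cong length (sym π≡)) len) (subst (All (Entry n)) π≡ ent) [] l ⟩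
  paths (prefixSums (afterBlock (length P) (length D))) 0 (length B)
    ≡⟨ paths-afterBlock (length P) (length D) (length B) ⟩
  binSum (λ j → ballot (suc j) (length B)) (length P) (length D)
    ≡⟨ formula≡binSum (length B) (length P) (length D) ⟨
  formula (suc (length B)) (length P) (suc (length D))
    ≡⟨ cong (λ m₁ → formula m₁ (length P) (suc (length D))) M₁-length ⟨
  formula (suc (length M)) (length P) (suc (length D)) ∎
  where
  π≡ : (m ∷ M) ++ P ++ d ∷ D ≡ B ++ z ∷ P ++ d ∷ D
  π≡ = trans (cong (_++ P ++ d ∷ D) split) (++-assoc B (z ∷ []) (P ++ d ∷ D))
  M₁-length : suc (length M) ≡ suc (length B)
  M₁-length = trans (cong length split) (trans (length-++ B) (+-comm (length B) 1))
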